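{- $\mathrm{HCTL}^+_1$ is $2^{O(n\log n)}$-succinct in $\mathrm{HCTL}_1$: there is a function $h\in 2^{O(n\log n)}$ such that every $\mathrm{HCTL}^+_1$ formula $\varphi$ has an equivalent $\mathrm{HCTL}_1$ formula $\varphi'$ with $|\varphi'|\le h(|\varphi|)$.
   Context: Models are rooted trees (finite or infinite), edges directed from parents to children, nodes labelled with sets of atomic propositions; a path from $v$ is a maximal downward sequence of nodes starting at $v$. Formulas of $\mathrm{HCTL}^*_1$ (one variable $x$): state formulas $\varphi ::= p \mid \neg\varphi \mid \varphi\lor\varphi \mid \varphi\land\varphi \mid \mathsf{E}\psi \mid \mathsf{A}\psi \mid {\downarrow}x\,\varphi \mid x \mid @_{x}\varphi \mid \mathit{root} \mid @_{\mathit{root}}\varphi$; path formulas $\psi ::= \varphi \mid \neg\psi \mid \psi\lor\psi\mid\psi\land\psi\mid \mathsf{X}\psi \mid \psi\,\mathsf{U}\,\psi$. Evaluation of state formulas at (tree $T$, node $v$, node $u$ assigned to $x$): $p$ holds if $p$ labels $v$; $\mathsf{E}\psi$/$\mathsf{A}\psi$: some/every path from $v$ satisfies $\psi$ at position 0; ${\downarrow}x\varphi$: $\varphi$ holds at $v$ with $x$ assigned $v$; $x$: $v=u$; $@_x\varphi$: $\varphi$ holds at $u$; $\mathit{root}$: $v$ is the root; $@_{\mathit{root}}\varphi$: $\varphi$ holds at the root. Path formulas at path $\pi$, position $i$: a state formula holds if it holds at $\pi(i)$; $\mathsf X\psi$: $\psi$ at $i+1$; $\psi_1\mathsf U\psi_2$: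 some $j\ge i$ has $\psi_2$ and all $l\in[i,j)$ have $\psi_1$. $\mathrm{HCTL}_1$: path formulas only $\mathsf{X}\varphi$, $\varphi_1\mathsf{U}\varphi_2$ with state formulas $\varphi,\varphi_i$. $\mathrm{HCTL}^+_1$: path formulas are Boolean combinations of such formulas. Equivalence: holding at exactly the same (tree, node, assignment) triples. $|\varphi|$ is the usual formula size. -}

module Defs where

open import Data.Nat using (ℕ; zero; suc; _+_; _*_; _^_; _≤_; _<_)
open import Data.Nat.Logarithm using (⌈log₂_⌉)
open import Data.Bool using (Bool; true)
open import Data.Maybe using (Maybe; just; nothing; _>>=_)
open import Data.Product using (Σ; ∃; _×_; _,_)
open import Data.Sum using (_⊎_)
open import Data.Unit using (⊤)
open import Data.Empty using (⊥)
open import Relation.Nullary using (¬_)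
open import Relation.Binary.PropositionalEquality using (_≡_)

Prop : Set
Prop = ℕ

mutual
  data StateF : Set where
    atom    : Prop → StateF
    ¬s_     : StateF → StateF
    _∨s_    : StateF → StateF → StateF
    _∧s_    : StateF → StateF → StateF
    E       : PathF → StateF
    A       : PathF → StateF
    ↓x      : StateF → StateF
    var-x   : StateF
    at-x    : StateF → StateF
    root    : StateF
    at-root : StateF → StateF

  data PathF : Set where
    st   : StateF → PathF
    ¬p_  : PathF → PathF
    _∨p_ : PathF → PathF → PathF
    _∧p_ : PathF → PathF → PathF
    X    : PathF → PathF
    _U_  : PathF → PathF → PathF

-- Formula size: number of symbols (the embedding `st` of state formulas
-- into path formulas is not a symbol and counts 0).

mutual
  size : StateF → ℕ
  size (atom p)    = 1
  size (¬s φ)      = suc (size φ)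
  size (φ ∨s ψ)    = suc (size φ + size ψ)
  size (φ ∧s ψ)    = suc (size φ + size ψ)
  size (E ψ)       = suc (sizeP ψ)
  size (A ψ)       = suc (sizeP ψ)
  size (↓x φ)      = suc (size φ)
  size var-x       = 1
  size (at-x φ)    = suc (size φ)
  size root        = 1
  size (at-root φ) = suc (size φ)

  sizeP : PathF → ℕ
  sizeP (st φ)   = size φ
  sizeP (¬p ψ)   = suc (sizeP ψ)
  sizeP (ψ ∨p χ) = suc (sizeP ψ + sizeP χ)
  sizeP (ψ ∧p χ) = suc (sizeP ψ + sizeP χ)
  sizeP (X ψ)    = suc (sizeP ψ)
  sizeP (ψ U χ)  = suc (sizeP ψ + sizeP χ)

mutual
  data IsHCTL : StateF → Set where
    atom    : ∀ p → IsHCTL (atom p)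
    ¬s_     : ∀ {φ} → IsHCTL φ → IsHCTL (¬s φ)
    _∨s_    : ∀ {φ ψ} → IsHCTL φ → IsHCTL ψ → IsHCTL (φ ∨s ψ)
    _∧s_    : ∀ {φ ψ} → IsHCTL φ → IsHCTL ψ → IsHCTL (φ ∧s ψ)
    E       : ∀ {ψ} → IsHCTLPath ψ → IsHCTL (E ψ)
    A       : ∀ {ψ} → IsHCTLPath ψ → IsHCTL (A ψ)
    ↓x      : ∀ {φ} → IsHCTL φ → IsHCTL (↓x φ)
    var-x   : IsHCTL var-x
    at-x    : ∀ {φ} → IsHCTL φ → IsHCTL (at-x φ)
    root    : IsHCTL root
    at-root : ∀ {φ} → IsHCTL φ → IsHCTL (at-root φ)

  data IsHCTLPath : PathF → Set where
    X   : ∀ {φ} → IsHCTL φ → IsHCTLPath (X (st φ))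
    _U_ : ∀ {φ ψ} → IsHCTL φ → IsHCTL ψ → IsHCTLPath (st φ U st ψ)

mutual
  data IsHCTL+ : StateF → Set where
    atom    : ∀ p → IsHCTL+ (atom p)
    ¬s_     : ∀ {φ} → IsHCTL+ φ → IsHCTL+ (¬s φ)
    _∨s_    : ∀ {φ ψ} → IsHCTL+ φ → IsHCTL+ ψ → IsHCTL+ (φ ∨s ψ)
    _∧s_    : ∀ {φ ψ} → IsHCTL+ φ → IsHCTL+ ψ → IsHCTL+ (φ ∧s ψ)
    E       : ∀ {ψ} → IsHCTL+Path ψ → IsHCTL+ (E ψ)
    A       : ∀ {ψ} → IsHCTL+Path ψ → IsHCTL+ (A ψ)
    ↓x      : ∀ {φ} → IsHCTL+ φ → IsHCTL+ (↓x φ)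
    var-x   : IsHCTL+ var-x
    at-x    : ∀ {φ} → IsHCTL+ φ → IsHCTL+ (at-x φ)
    root    : IsHCTL+ root
    at-root : ∀ {φ} → IsHCTL+ φ → IsHCTL+ (at-root φ)

  data IsHCTL+Path : PathF → Set where
    st   : ∀ {φ} → IsHCTL+ φ → IsHCTL+Path (st φ)
    ¬p_  : ∀ {ψ} → IsHCTL+Path ψ → IsHCTL+Path (¬p ψ)
    _∨p_ : ∀ {ψ χ} → IsHCTL+Path ψ → IsHCTL+Path χ → IsHCTL+Path (ψ ∨p χ)
    _∧p_ : ∀ {ψ χ} → IsHCTL+Path ψ → IsHCTL+Path χ → IsHCTL+Path (ψ ∧p χ)
    X    : ∀ {φ} → IsHCTL+ φ → IsHCTL+Path (X (st φ))
    _U_  : ∀ {φ ψ} → IsHCTL+ φ → IsHCTL+ ψ → IsHCTL+Path (st φ U st ψ)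

-- Models: rooted trees (finite or infinite, arbitrary branching),
-- given by a parent function; every node reaches the root.

ancestor : {N : Set} → (N → Maybe N) → ℕ → N → Maybe N
ancestor par zero    v = just v
ancestor par (suc n) v = par v >>= ancestor par n

record Tree : Set₁ where
  field
    Node        : Set
    troot       : Node
    parent      : Node → Maybe Node
    label       : Node → Prop → Bool
    root-parent : parent troot ≡ nothing
    reach       : ∀ v → ∃ λ n → ancestor parent n v ≡ just troot

open Tree public

Child : (T : Tree) → Node T → Node T → Set
Child T v w = parent T w ≡ just v

-- Paths: maximal downward sequences. `last = nothing` means infinite,
-- `last = just n` means the path has positions 0..n and ends in a leaf.
InPath : Maybe ℕ → ℕ → Set
InPath nothing  i = ⊤
InPath (just n) i = i ≤ n

record Path (T : Tree) : Set where
  field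
    seq     : ℕ → Node T
    last    : Maybe ℕ
    step    : ∀ i → InPath last (suc i) → Child T (seq i) (seq (suc i))
    maximal : ∀ n → last ≡ just n → ∀ w → ¬ Child T (seq n) w

open Path public

-- Semantics: ⟦ φ ⟧ T v u  (v current node, u the node assigned to x)

mutual
  ⟦_⟧ : StateF → (T : Tree) → Node T → Node T → Set
  ⟦ atom p ⟧    T v u = label T v p ≡ true
  ⟦ ¬s φ ⟧      T v u = ¬ ⟦ φ ⟧ T v u
  ⟦ φ ∨s ψ ⟧    T v u = ⟦ φ ⟧ T v u ⊎ ⟦ ψ ⟧ T v u
  ⟦ φ ∧s ψ ⟧    T v u = ⟦ φ ⟧ T v u × ⟦ ψ ⟧ T v u
  ⟦ E ψ ⟧       T v u = Σ (Path T) λ π → seq π 0 ≡ v × ⟦ ψ ⟧P T π 0 u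
  ⟦ A ψ ⟧       T v u = (π : Path T) → seq π 0 ≡ v → ⟦ ψ ⟧P T π 0 u
  ⟦ ↓x φ ⟧      T v u = ⟦ φ ⟧ T v v
  ⟦ var-x ⟧     T v u = v ≡ u
  ⟦ at-x φ ⟧    T v u = ⟦ φ ⟧ T u u
  ⟦ root ⟧      T v u = v ≡ troot T
  ⟦ at-root φ ⟧ T v u = ⟦ φ ⟧ T (troot T) u

  -- evaluated at positions i of the path (only valid positions are ever used)
  ⟦_⟧P : PathF → (T : Tree) → Path T → ℕ → Node T → Set
  ⟦ st φ ⟧P   T π i u = ⟦ φ ⟧ T (seq π i) u
  ⟦ ¬p ψ ⟧P   T π i u = ¬ ⟦ ψ ⟧P T π i u
  ⟦ ψ ∨p χ ⟧P T π i u = ⟦ ψ ⟧P T π i u ⊎ ⟦ χ ⟧P T π i u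
  ⟦ ψ ∧p χ ⟧P T π i u = ⟦ ψ ⟧P T π i u × ⟦ χ ⟧P T π i u
  ⟦ X ψ ⟧P    T π i u = InPath (last π) (suc i) × ⟦ ψ ⟧P T π (suc i) u
  ⟦ ψ U χ ⟧P  T π i u = Σ ℕ λ j → i ≤ j × InPath (last π) j × ⟦ χ ⟧P T π j u
                           × (∀ l → i ≤ l → l < j → ⟦ ψ ⟧P T π l u)

_≅_ : StateF → StateF → Set₁
φ ≅ ψ = ∀ (T : Tree) (v u : Node T) →
          (⟦ φ ⟧ T v u → ⟦ ψ ⟧ T v u) × (⟦ ψ ⟧ T v u → ⟦ φ ⟧ T v u)

In2^O[nlogn] : (ℕ → ℕ) → Set
In2^O[nlogn] h = Σ ℕ λ c → Σ ℕ λ N → ∀ n → N ≤ n → h n ≤ 2 ^ (c * (n * ⌈log₂ n ⌉))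

module Submission where

-- Every HCTL+_1 formula φ of size n is translated into an equivalent
-- HCTL_1 formula  tr φ  of size at most (12 (n + 1)) ^ (6 n).  The
-- translation commutes with all connectives except the path quantifiers.
-- For  E ψ  the path formula ψ is first put into normal form: a Boolean
-- function of its atoms, which are state formulas, next formulas  X φ
-- and until formulas  a U b .  E ψ  is then expressed by nested case
-- distinctions: on the truth values of the state atoms at the current
-- node; on which until atom is decided first along the path (a U b  is
-- undecided at a node satisfying  a ∧ ¬b , and decided as true or false
-- otherwise), continuing recursively with the remaining atoms; and, while
-- all until atoms are undecided, on whether the path ends here or moves
-- to a successor, where the next atoms become state atoms.  A ψ  is
-- translated as  ¬E¬ψ .  Enumerating the orders in which k until atoms
-- can be decided costs a factor of order k!, which gives the bound.

open import Defs
open import Level using (0ℓ)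
open import Axiom.ExcludedMiddle using (ExcludedMiddle)
open import Data.Nat using (ℕ; zero; suc; _+_; _*_; _∸_; _^_; _≤_; _<_; z≤n; s≤s; NonZero; >-nonZero; ⌈_/2⌉)
open import Data.Nat.Properties
open import Data.Nat.Induction using (<-rec; <-wellFounded)
open import Data.Nat.Logarithm using (⌈log₂_⌉)
open import Data.Nat.Logarithm.Core using (⌈log2⌉)
open import Data.Nat.Tactic.RingSolver using (solve-∀)
open import Induction.WellFounded using (Acc; acc)
open import Data.Bool using (Bool; true; false; not; _∧_; _∨_) renaming (T to IsTrue)
open import Data.Bool.Properties using (T-∧; T-∨)
open import Data.Fin using (Fin; zero; suc)
open import Data.Vec as V using (Vec; []; _∷_; _++_; lookup; insertAt; removeAt; replicate)
import Data.Vec.Properties as VP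
open import Data.Vec.Relation.Unary.All using (All; []; _∷_)
import Data.Vec.Relation.Unary.All.Properties as All
open import Data.Maybe using (just; nothing)
import Data.Maybe as M
open import Data.Product using (Σ; _×_; _,_; proj₁; proj₂)
open import Data.Product.Function.NonDependent.Propositional using (_×-⇔_)
open import Data.Sum using (_⊎_; inj₁; inj₂)
open import Data.Sum.Function.Propositional using (_⊎-⇔_)
open import Data.Unit using (⊤; tt)
open import Data.Empty using (⊥-elim)
open import Relation.Nullary using (¬_; yes; no; does)
open import Relation.Nullary.Decidable using (dec-true; dec-false; does-⇔)
open import Relation.Binary using (tri<; tri≈; tri>)
open import Relation.Binary.PropositionalEquality
open import Function using (_∘_)
open import Function.Bundles using (_⇔_; mk⇔; Equivalence)
open import Function.Construct.Identity using (⇔-id)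
open import Function.Construct.Symmetry using (⇔-sym)
open import Function.Construct.Composition using (_⇔-∘_)
open import Function.Related.TypeIsomorphisms using (¬-cong-⇔)

map-removeAt : ∀ {A B : Set} {n} (f : A → B) (xs : Vec A (suc n)) (i : Fin (suc n)) →
               V.map f (removeAt xs i) ≡ removeAt (V.map f xs) i
map-removeAt f (x ∷ xs)     zero    = refl
map-removeAt f (x ∷ y ∷ xs) (suc i) = cong (f x ∷_) (map-removeAt f (y ∷ xs) i)

take-drop-map-++ : ∀ {A B : Set} {m n} (f : A → B) (xs : Vec A m) (ys : Vec A n) →
  V.take m (V.map f (xs ++ ys)) ≡ V.map f xs × V.drop m (V.map f (xs ++ ys)) ≡ V.map f ys
take-drop-map-++ {B = B} {m} {n} f xs ys = VP.++-injective (V.take m zs) (V.map f xs)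
  (trans (VP.take++drop≡id m zs) (VP.map-++ f xs ys))
  where
  zs : Vec B (m + n)
  zs = V.map f (xs ++ ys)

cong₃ : ∀ {A B C D : Set} (f : A → B → C → D) {a a′ b b′ c c′} →
        a ≡ a′ → b ≡ b′ → c ≡ c′ → f a b c ≡ f a′ b′ c′
cong₃ f refl refl refl = refl

IsTrue-not : ∀ {b} → IsTrue (not b) ⇔ (¬ IsTrue b)
IsTrue-not {true}  = mk⇔ (λ ()) (λ n → n tt)
IsTrue-not {false} = mk⇔ (λ _ ()) (λ _ → tt)

module PathSurgery (T : Tree) where

  InPath-mono : ∀ l {i j} → i ≤ j → InPath l j → InPath l i
  InPath-mono nothing  _   _   = tt
  InPath-mono (just n) i≤j j≤n = ≤-trans i≤j j≤n

  InPath-zero : ∀ l → InPath l 0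
  InPath-zero nothing  = tt
  InPath-zero (just n) = z≤n

  record Agree (π : Path T) (p : ℕ) (ρ : Path T) (q : ℕ) : Set where
    field
      nodes  : ∀ i → seq π (p + i) ≡ seq ρ (q + i)
      valid  : ∀ i → InPath (last π) (p + i) → InPath (last ρ) (q + i)
      valid⁻ : ∀ i → InPath (last ρ) (q + i) → InPath (last π) (p + i)

  Agree-sym : ∀ {π p ρ q} → Agree π p ρ q → Agree ρ q π p
  Agree-sym ag = record { nodes = λ i → sym (nodes i) ; valid = valid⁻ ; valid⁻ = valid }
    where open Agree ag

  InPath-suffix : ∀ l t i → InPath l t → InPath (M.map (_∸ t) l) i → InPath l (t + i)
  InPath-suffix nothing  t i _   _  = tt
  InPath-suffix (just n) t i t≤n le = subst (t + i ≤_) (m+[n∸m]≡n t≤n) (+-monoʳ-≤ t le)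

  InPath-suffix⁻ : ∀ l t i → InPath l t → InPath l (t + i) → InPath (M.map (_∸ t) l) i
  InPath-suffix⁻ nothing  t i _   _  = tt
  InPath-suffix⁻ (just n) t i t≤n le =
    +-cancelˡ-≤ t i (n ∸ t) (subst (t + i ≤_) (sym (m+[n∸m]≡n t≤n)) le)

  suffix : (π : Path T) (t : ℕ) → InPath (last π) t → Path T
  suffix π t vt = record
    { seq = λ i → seq π (t + i) ; last = M.map (_∸ t) (last π)
    ; step = step′ ; maximal = maximal′ }
    where
    step′ : ∀ i → InPath (M.map (_∸ t) (last π)) (suc i) → Child T (seq π (t + i)) (seq π (t + suc i))
    step′ i v = subst (Child T (seq π (t + i)) ∘ seq π) (sym (+-suc t i))
      (step π (t + i) (subst (InPath (last π)) (+-suc t i) (InPath-suffix (last π) t (suc i) vt v)))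
    maximal′ : ∀ n → M.map (_∸ t) (last π) ≡ just n → ∀ w → ¬ Child T (seq π (t + n)) w
    maximal′ n eq w c with last π in eqL
    maximal′ n refl w c | just m =
      maximal π m eqL w (subst (λ z → Child T (seq π z) w) (m+[n∸m]≡n vt) c)

  suffix-agree : ∀ π t vt → Agree (suffix π t vt) 0 π t
  suffix-agree π t vt = record
    { nodes = λ i → refl
    ; valid = λ i → InPath-suffix (last π) t i vt
    ; valid⁻ = λ i → InPath-suffix⁻ (last π) t i vt }

  prefixThen : {N : Set} → ℕ → (ℕ → N) → (ℕ → N) → ℕ → N
  prefixThen zero    f g i       = g i
  prefixThen (suc t) f g zero    = f zero
  prefixThen (suc t) f g (suc i) = prefixThen t (f ∘ suc) g i

  prefixThen-< : {N : Set} → ∀ t (f g : ℕ → N) i → i < t → prefixThen t f g i ≡ f i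
  prefixThen-< (suc t) f g zero    _        = refl
  prefixThen-< (suc t) f g (suc i) (s≤s lt) = prefixThen-< t (f ∘ suc) g i lt

  prefixThen-+ : {N : Set} → ∀ t (f g : ℕ → N) i → prefixThen t f g (t + i) ≡ g i
  prefixThen-+ zero    f g i = refl
  prefixThen-+ (suc t) f g i = prefixThen-+ t (f ∘ suc) g i

  splice : (π : Path T) (t : ℕ) → InPath (last π) t → (ρ : Path T) → seq ρ 0 ≡ seq π t → Path T
  splice π t vt ρ eq = record
    { seq = S ; last = M.map (t +_) (last ρ) ; step = step′ ; maximal = maximal′ }
    where
    S : ℕ → Node T
    S = prefixThen t (seq π) (seq ρ)
    S-t : S t ≡ seq π t
    S-t = trans (cong S (sym (+-identityʳ t))) (trans (prefixThen-+ t (seq π) (seq ρ) 0) eq)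
    inρ : ∀ l d → InPath (M.map (t +_) l) (t + d) → InPath l d
    inρ nothing  d _  = tt
    inρ (just n) d le = +-cancelˡ-≤ t d n le
    step′ : ∀ i → InPath (M.map (t +_) (last ρ)) (suc i) → Child T (S i) (S (suc i))
    step′ i v with <-cmp (suc i) t
    ... | tri< 1+i<t _ _ =
      subst₂ (Child T) (sym (prefixThen-< t (seq π) (seq ρ) i (<-trans (n<1+n i) 1+i<t)))
        (sym (prefixThen-< t (seq π) (seq ρ) (suc i) 1+i<t))
        (step π i (InPath-mono (last π) (<⇒≤ 1+i<t) vt))
    ... | tri≈ _ refl _ =
      subst₂ (Child T) (sym (prefixThen-< t (seq π) (seq ρ) i (n<1+n i))) (sym S-t) (step π i vt)
    ... | tri> _ _ t<1+i =
      subst₂ (Child T) (trans (sym (prefixThen-+ t (seq π) (seq ρ) d)) (cong S t+d≡i))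
        (trans (sym (prefixThen-+ t (seq π) (seq ρ) (suc d))) (cong S (trans (+-suc t d) (cong suc t+d≡i))))
        (step ρ d (inρ (last ρ) (suc d) (subst (InPath (M.map (t +_) (last ρ)))
          (sym (trans (+-suc t d) (cong suc t+d≡i))) v)))
      where
      d : ℕ
      d = i ∸ t
      t+d≡i : t + d ≡ i
      t+d≡i = m+[n∸m]≡n (≤-pred t<1+i)
    maximal′ : ∀ n → M.map (t +_) (last ρ) ≡ just n → ∀ w → ¬ Child T (S n) w
    maximal′ n eq′ w c with last ρ in eqL
    maximal′ n refl w c | just m =
      maximal ρ m eqL w (subst (λ z → Child T z w) (prefixThen-+ t (seq π) (seq ρ) m) c)

  splice-prefix : ∀ π t vt ρ eq i → i ≤ t → seq (splice π t vt ρ eq) i ≡ seq π i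
  splice-prefix π t vt ρ eq i i≤t with m≤n⇒m<n∨m≡n i≤t
  ... | inj₁ i<t  = prefixThen-< t (seq π) (seq ρ) i i<t
  ... | inj₂ refl = trans (cong (prefixThen t (seq π) (seq ρ)) (sym (+-identityʳ t)))
                          (trans (prefixThen-+ t (seq π) (seq ρ) 0) eq)

  splice-agree : ∀ π t vt ρ eq → Agree (splice π t vt ρ eq) t ρ 0
  splice-agree π t vt ρ eq = record
    { nodes = prefixThen-+ t (seq π) (seq ρ)
    ; valid = λ i → valid (last ρ) i
    ; valid⁻ = λ i → valid⁻ (last ρ) i }
    where
    valid : ∀ l i → InPath (M.map (t +_) l) (t + i) → InPath l i
    valid nothing  i _ = tt
    valid (just n) i   = +-cancelˡ-≤ t i n
    valid⁻ : ∀ l i → InPath l i → InPath (M.map (t +_) l) (t + i)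
    valid⁻ nothing  i _ = tt
    valid⁻ (just n) i   = +-monoʳ-≤ t

-- The HCTL_1 building blocks of the translation.

-- An until atom  a U b  is represented by the pair (a , b).
UntilAtom : Set
UntilAtom = StateF × StateF

⊤f ⊥f : StateF
⊤f = root ∨s (¬s root)
⊥f = ¬s ⊤f

constF : Bool → StateF
constF true  = ⊤f
constF false = ⊥f

undecided : ∀ {k} → Vec UntilAtom k → StateF
undecided []             = ⊤f
undecided ((a , b) ∷ us) = (a ∧s (¬s b)) ∧s undecided us

bigOr : (n : ℕ) → (Fin n → StateF) → StateF
bigOr zero    f = ⊥f
bigOr (suc n) f = f zero ∨s bigOr n (f ∘ suc)

-- Branch on how  a U b  is decided at the current node: true if b holds,
-- false if neither a nor b holds.
decide : UntilAtom → (Bool → StateF) → StateF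
decide (a , b) R = (b ∧s R true) ∨s (((¬s a) ∧s (¬s b)) ∧s R false)

caseSplit : ∀ {n} → Vec StateF n → (Vec Bool n → StateF) → StateF
caseSplit []       F = F []
caseSplit (s ∷ ss) F = (s ∧s caseSplit ss (F ∘ (true ∷_))) ∨s ((¬s s) ∧s caseSplit ss (F ∘ (false ∷_)))

fixAt : ∀ {k} → Fin (suc k) → Bool → (Vec Bool (suc k) → Bool) → Vec Bool k → Bool
fixAt i c g bs = g (insertAt bs i c)

-- untils k us g  says that some path from the current node makes g true
-- on the values of the until atoms us at its start.  Either some atom i
-- is the first to be decided along the path (all atoms staying undecided
-- before), and the remaining atoms are handled recursively from there on,
-- or no atom is ever decided, in which case all of them are false.
mutual
  untils : (k : ℕ) → Vec UntilAtom k → (Vec Bool k → Bool) → StateF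
  untils k us g = someDecided k us g ∨s neverDecided us g

  someDecided : (k : ℕ) → Vec UntilAtom k → (Vec Bool k → Bool) → StateF
  someDecided zero    us g = ⊥f
  someDecided (suc k) us g = bigOr (suc k) (firstDecided k us g)

  firstDecided : (k : ℕ) → Vec UntilAtom (suc k) → (Vec Bool (suc k) → Bool) → Fin (suc k) → StateF
  firstDecided k us g i =
    E (st (undecided us) U st (decide (lookup us i) λ c → untils k (removeAt us i) (fixAt i c g)))

  neverDecided : ∀ {k} → Vec UntilAtom k → (Vec Bool k → Bool) → StateF
  neverDecided {k} us g with g (replicate k false)
  ... | true  = ¬s A (st ⊤f U st (¬s undecided us))
  ... | false = ⊥f

-- The path ends at the current node, and the Boolean combination is true
-- for the value c: no next atom holds and, as all until atoms are
-- undecided here, none of them holds either.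
atLeaf : Bool → StateF
atLeaf c = (¬s A (X (st ⊤f))) ∧s constF c

-- The path continues: next atoms become state atoms of the successor.
moveOn : ∀ {m} (k : ℕ) → Vec StateF m → Vec UntilAtom k → (Vec Bool m → Vec Bool k → Bool) → StateF
moveOn k xs us g = E (X (st (caseSplit xs λ bx → untils k us (g bx))))

-- nextUntils k xs us g  says that some path from the current node makes
-- g true on the values of the next atoms xs and the until atoms us at its
-- start.  Either some until atom is decided at the current node, and the
-- others are handled recursively, or all are undecided here and the path
-- ends or continues.
mutual
  nextUntils : ∀ {m} (k : ℕ) → Vec StateF m → Vec UntilAtom k → (Vec Bool m → Vec Bool k → Bool) → StateF
  nextUntils {m} k xs us g =
    decidedNow k xs us g ∨s (undecided us ∧s (atLeaf (g (replicate m false) (replicate k false)) ∨s moveOn k xs us g))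

  decidedNow : ∀ {m} (k : ℕ) → Vec StateF m → Vec UntilAtom k → (Vec Bool m → Vec Bool k → Bool) → StateF
  decidedNow zero    xs us g = ⊥f
  decidedNow (suc k) xs us g = bigOr (suc k) (decidedHere k xs us g)

  decidedHere : ∀ {m} (k : ℕ) → Vec StateF m → Vec UntilAtom (suc k) → (Vec Bool m → Vec Bool (suc k) → Bool) → Fin (suc k) → StateF
  decidedHere k xs us g i = decide (lookup us i) λ c → nextUntils k xs (removeAt us i) (λ bx → fixAt i c (g bx))

-- Normal form of an HCTL+_1 path formula: a Boolean function of its state
-- atoms, next atoms  X φ  and until atoms  a U b .
record NF : Set where
  constructor nf
  field
    {ns nx nu} : ℕ
    stAtoms : Vec StateF ns
    nxAtoms : Vec StateF nx
    unAtoms : Vec UntilAtom nu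
    combo   : Vec Bool ns → Vec Bool nx → Vec Bool nu → Bool
open NF

combine : (Bool → Bool → Bool) → NF → NF → NF
combine op c₁ c₂ = nf (stAtoms c₁ ++ stAtoms c₂) (nxAtoms c₁ ++ nxAtoms c₂) (unAtoms c₁ ++ unAtoms c₂)
  λ bs bx bu → op (combo c₁ (V.take (ns c₁) bs) (V.take (nx c₁) bx) (V.take (nu c₁) bu))
                  (combo c₂ (V.drop (ns c₁) bs) (V.drop (nx c₁) bx) (V.drop (nu c₁) bu))

negNF : NF → NF
negNF c = record c { combo = λ bs bx bu → not (combo c bs bx bu) }

existsNF : NF → StateF
existsNF c = caseSplit (stAtoms c) λ bs → nextUntils (nu c) (nxAtoms c) (unAtoms c) (combo c bs)

mutual
  tr : (φ : StateF) → IsHCTL+ φ → StateF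
  tr (atom p)    _           = atom p
  tr (¬s φ)      (¬s d)      = ¬s tr φ d
  tr (φ ∨s ψ)    (d ∨s e)    = tr φ d ∨s tr ψ e
  tr (φ ∧s ψ)    (d ∧s e)    = tr φ d ∧s tr ψ e
  tr (E ψ)       (E d)       = existsNF (normalForm ψ d)
  tr (A ψ)       (A d)       = ¬s existsNF (negNF (normalForm ψ d))
  tr (↓x φ)      (↓x d)      = ↓x (tr φ d)
  tr var-x       _           = var-x
  tr (at-x φ)    (at-x d)    = at-x (tr φ d)
  tr root        _           = root
  tr (at-root φ) (at-root d) = at-root (tr φ d)

  normalForm : (ψ : PathF) → IsHCTL+Path ψ → NF
  normalForm (st φ)         (st d)   = nf (tr φ d ∷ []) [] [] λ bs _ _ → V.head bs
  normalForm (¬p ψ)         (¬p d)   = negNF (normalForm ψ d)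
  normalForm (ψ ∨p χ)       (d ∨p e) = combine _∨_ (normalForm ψ d) (normalForm χ e)
  normalForm (ψ ∧p χ)       (d ∧p e) = combine _∧_ (normalForm ψ d) (normalForm χ e)
  normalForm (X (st φ))     (X d)    = nf [] (tr φ d ∷ []) [] λ _ bx _ → V.head bx
  normalForm (st a U st b)  (d U e)  = nf [] [] ((tr a d , tr b e) ∷ []) λ _ _ bu → V.head bu

-- Everything is relative to a tree T and a fixed assignment u of x;
-- excluded middle turns propositions into truth values.
module Semantics (em : ExcludedMiddle 0ℓ) (T : Tree) (u : Node T) where
  open PathSurgery T public

  Sat : StateF → Node T → Set
  Sat φ w = ⟦ φ ⟧ T w u

  truth : Set → Bool
  truth P = does (em {P})

  truth-yes : ∀ {P} → P → truth P ≡ true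
  truth-yes {P} = dec-true (em {P})

  truth-no : ∀ {P} → ¬ P → truth P ≡ false
  truth-no {P} = dec-false (em {P})

  truth-sound : ∀ {P} → IsTrue (truth P) → P
  truth-sound {P} with em {P}
  ... | yes p = λ _ → p
  ... | no _  = λ ()

  truth-complete : ∀ {P} → P → IsTrue (truth P)
  truth-complete p = subst IsTrue (sym (truth-yes p)) tt

  truth-cong : ∀ {P Q} → (P → Q) → (Q → P) → truth P ≡ truth Q
  truth-cong {P} {Q} f g = does-⇔ (mk⇔ f g) (em {P}) (em {Q})

  truth-⇔ : ∀ {P Q : Set} → P ⇔ Q → P ⇔ IsTrue (truth Q)
  truth-⇔ P⇔Q = mk⇔ (truth-complete ∘ Equivalence.to P⇔Q) (Equivalence.from P⇔Q ∘ truth-sound)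

  dne : ∀ {P} → ¬ ¬ P → P
  dne {P} nnp with em {P}
  ... | yes p = p
  ... | no np = ⊥-elim (nnp np)

  minimize : (P : ℕ → Set) → ∀ n → P n → Σ ℕ λ m → P m × (∀ e → e < m → ¬ P e)
  minimize P = <-rec (λ n → P n → Σ ℕ λ m → P m × (∀ e → e < m → ¬ P e)) least
    where
    least : ∀ n → (∀ {e} → e < n → P e → Σ ℕ λ m → P m × (∀ e → e < m → ¬ P e)) →
            P n → Σ ℕ λ m → P m × (∀ e → e < m → ¬ P e)
    least n smaller pn with em {Σ ℕ λ e → e < n × P e}
    ... | yes (e , e<n , pe) = smaller e<n pe
    ... | no none            = n , pn , λ e e<n pe → none (e , e<n , pe)

  EPath : Node T → (Path T → Set) → Set
  EPath v P = Σ (Path T) λ π → seq π 0 ≡ v × P π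

  counterexample : ∀ v (ψ : PathF) → ¬ ⟦ A ψ ⟧ T v u → EPath v λ π → ¬ ⟦ ψ ⟧P T π 0 u
  counterexample v ψ nA = dne λ none → nA λ π e → dne λ nψ → none (π , e , nψ)

  -- ⊤f  is valid, being an instance of excluded middle.
  ⊤f-holds : ∀ w → Sat ⊤f w
  ⊤f-holds w with em {w ≡ troot T}
  ... | yes r = inj₁ r
  ... | no nr = inj₂ nr

  ⊥f-fails : ∀ w → ¬ Sat ⊥f w
  ⊥f-fails w n = n (⊤f-holds w)

  constF-sem : ∀ c w → Sat (constF c) w → IsTrue c
  constF-sem true  w _ = tt
  constF-sem false w s = ⊥f-fails w s

  constF-sem⁻ : ∀ c w → IsTrue c → Sat (constF c) w
  constF-sem⁻ true w _ = ⊤f-holds w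

  bigOr-sem : ∀ n f w → Sat (bigOr n f) w → Σ (Fin n) λ i → Sat (f i) w
  bigOr-sem zero    f w s        = ⊥-elim (⊥f-fails w s)
  bigOr-sem (suc n) f w (inj₁ s) = zero , s
  bigOr-sem (suc n) f w (inj₂ s) with bigOr-sem n (f ∘ suc) w s
  ... | i , s′ = suc i , s′

  bigOr-sem⁻ : ∀ n f w (i : Fin n) → Sat (f i) w → Sat (bigOr n f) w
  bigOr-sem⁻ (suc n) f w zero    s = inj₁ s
  bigOr-sem⁻ (suc n) f w (suc i) s = inj₂ (bigOr-sem⁻ n (f ∘ suc) w i s)

  valN : ∀ {n} → Vec StateF n → Node T → Vec Bool n
  valN ss w = V.map (λ s → truth (Sat s w)) ss

  caseSplit-sem : ∀ {n} (ss : Vec StateF n) F w → Sat (caseSplit ss F) w → Sat (F (valN ss w)) w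
  caseSplit-sem []       F w s = s
  caseSplit-sem (s ∷ ss) F w (inj₁ (hs , r)) =
    subst (λ c → Sat (F (c ∷ valN ss w)) w) (sym (truth-yes hs)) (caseSplit-sem ss _ w r)
  caseSplit-sem (s ∷ ss) F w (inj₂ (ns , r)) =
    subst (λ c → Sat (F (c ∷ valN ss w)) w) (sym (truth-no ns)) (caseSplit-sem ss _ w r)

  caseSplit-sem⁻ : ∀ {n} (ss : Vec StateF n) F w → Sat (F (valN ss w)) w → Sat (caseSplit ss F) w
  caseSplit-sem⁻ []       F w s = s
  caseSplit-sem⁻ (s ∷ ss) F w r with em {Sat s w}
  ... | yes hs = inj₁ (hs , caseSplit-sem⁻ ss _ w r)
  ... | no ns  = inj₂ (ns , caseSplit-sem⁻ ss _ w r)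

  Undecided : UntilAtom → Node T → Set
  Undecided (a , b) w = Sat a w × ¬ Sat b w

  DecidedAs : UntilAtom → Bool → Node T → Set
  DecidedAs (a , b) true  w = Sat b w
  DecidedAs (a , b) false w = ¬ Sat a w × ¬ Sat b w

  AllUndecided : ∀ {k} → Vec UntilAtom k → Node T → Set
  AllUndecided []        w = ⊤
  AllUndecided (ab ∷ us) w = Undecided ab w × AllUndecided us w

  undecided-sem : ∀ {k} (us : Vec UntilAtom k) w → Sat (undecided us) w → AllUndecided us w
  undecided-sem []             w _        = tt
  undecided-sem ((a , b) ∷ us) w (h , hs) = h , undecided-sem us w hs

  undecided-sem⁻ : ∀ {k} (us : Vec UntilAtom k) w → AllUndecided us w → Sat (undecided us) w
  undecided-sem⁻ []             w _        = ⊤f-holds w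
  undecided-sem⁻ ((a , b) ∷ us) w (h , hs) = h , undecided-sem⁻ us w hs

  someDecidedAt : ∀ {k} (us : Vec UntilAtom k) w → ¬ AllUndecided us w →
                  Σ (Fin k) λ i → Σ Bool λ c → DecidedAs (lookup us i) c w
  someDecidedAt []             w nall = ⊥-elim (nall tt)
  someDecidedAt ((a , b) ∷ us) w nall with em {Undecided (a , b) w}
  ... | yes und = let (i , c , dec) = someDecidedAt us w (λ all → nall (und , all)) in suc i , c , dec
  ... | no nund with em {Sat b w}
  ...   | yes hb = zero , true , hb
  ...   | no nb  = zero , false , (λ ha → nund (ha , nb)) , nb

  decide-sem : ∀ ab R w → Sat (decide ab R) w → Σ Bool λ c → DecidedAs ab c w × Sat (R c) w
  decide-sem (a , b) R w (inj₁ (hb , r))   = true , hb , r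
  decide-sem (a , b) R w (inj₂ (nanb , r)) = false , nanb , r

  decide-sem⁻ : ∀ ab R w c → DecidedAs ab c w → Sat (R c) w → Sat (decide ab R) w
  decide-sem⁻ (a , b) R w true  hb   r = inj₁ (hb , r)
  decide-sem⁻ (a , b) R w false nanb r = inj₂ (nanb , r)

  UntilAt : Path T → ℕ → UntilAtom → Set
  UntilAt π p (a , b) = Σ ℕ λ d → InPath (last π) (p + d) × Sat b (seq π (p + d))
                                  × (∀ e → e < d → Sat a (seq π (p + e)))

  NextAt : Path T → ℕ → StateF → Set
  NextAt π p φ = InPath (last π) (suc p) × Sat φ (seq π (suc p))

  valU : ∀ {k} → Vec UntilAtom k → Path T → ℕ → Vec Bool k
  valU us π p = V.map (λ ab → truth (UntilAt π p ab)) us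

  valX : ∀ {n} → Vec StateF n → Path T → ℕ → Vec Bool n
  valX xs π p = V.map (λ φ → truth (NextAt π p φ)) xs

  UntilAt-agree : ∀ {π p ρ q} → Agree π p ρ q → ∀ ab → UntilAt π p ab → UntilAt ρ q ab
  UntilAt-agree ag (a , b) (d , vd , hb , ha) =
    d , valid d vd , subst (Sat b) (nodes d) hb , λ e e<d → subst (Sat a) (nodes e) (ha e e<d)
    where open Agree ag

  valU-agree : ∀ {π p ρ q} → Agree π p ρ q → ∀ {k} (us : Vec UntilAtom k) → valU us π p ≡ valU us ρ q
  valU-agree ag = VP.map-cong λ ab → truth-cong (UntilAt-agree ag ab) (UntilAt-agree (Agree-sym ag) ab)

  valX-next : ∀ π p {n} (xs : Vec StateF n) → InPath (last π) (suc p) → valX xs π p ≡ valN xs (seq π (suc p))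
  valX-next π p xs v = VP.map-cong (λ φ → truth-cong proj₂ (v ,_)) xs

  valX-leaf : ∀ π → ¬ InPath (last π) 1 → ∀ {n} (xs : Vec StateF n) → valX xs π 0 ≡ replicate n false
  valX-leaf π end []       = refl
  valX-leaf π end (φ ∷ xs) = cong₂ _∷_ (truth-no (end ∘ proj₁)) (valX-leaf π end xs)

  endsAt0 : ∀ (π : Path T) → ¬ InPath (last π) 1 → ∀ j → InPath (last π) j → j ≡ 0
  endsAt0 π end j vj with last π
  ... | nothing       = ⊥-elim (end tt)
  ... | just zero     = n≤0⇒n≡0 vj
  ... | just (suc n)  = ⊥-elim (end (s≤s z≤n))

  UndecidedBefore : ∀ {k} → Vec UntilAtom k → Path T → ℕ → Set
  UndecidedBefore us π j = ∀ e → e < j → AllUndecided us (seq π e)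

  AlwaysUndecided : ∀ {k} → Vec UntilAtom k → Path T → Set
  AlwaysUndecided us π = ∀ j → InPath (last π) j → AllUndecided us (seq π j)

  UntilAt-skip : ∀ π j ab → (∀ e → e < j → Undecided ab (seq π e)) → UntilAt π 0 ab → UntilAt π j ab
  UntilAt-skip π j (a , b) und (d , vd , hb , ha) with ≤-<-connex j d
  ... | inj₂ d<j = ⊥-elim (proj₂ (und d d<j) hb)
  ... | inj₁ j≤d =
    d ∸ j , subst (InPath (last π)) (sym j+d′) vd , subst (Sat b ∘ seq π) (sym j+d′) hb ,
    λ e e<d′ → ha (j + e) (subst (j + e <_) j+d′ (+-monoʳ-< j e<d′))
    where
    j+d′ : j + (d ∸ j) ≡ d
    j+d′ = m+[n∸m]≡n j≤d

  UntilAt-skip⁻ : ∀ π j ab → (∀ e → e < j → Undecided ab (seq π e)) → UntilAt π j ab → UntilAt π 0 ab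
  UntilAt-skip⁻ π j (a , b) und (d , vd , hb , ha) = j + d , vd , hb , holdsA
    where
    holdsA : ∀ e → e < j + d → Sat a (seq π e)
    holdsA e e<j+d with <-≤-connex e j
    ... | inj₁ e<j = proj₁ (und e e<j)
    ... | inj₂ j≤e = subst (Sat a ∘ seq π) (m+[n∸m]≡n j≤e)
           (ha (e ∸ j) (+-cancelˡ-< j (e ∸ j) d (subst (_< j + d) (sym (m+[n∸m]≡n j≤e)) e<j+d)))

  valU-stable : ∀ {k} (us : Vec UntilAtom k) π j → UndecidedBefore us π j → valU us π 0 ≡ valU us π j
  valU-stable []        π j und = refl
  valU-stable (ab ∷ us) π j und = cong₂ _∷_
    (truth-cong (UntilAt-skip π j ab (λ e e<j → proj₁ (und e e<j))) (UntilAt-skip⁻ π j ab (λ e e<j → proj₁ (und e e<j))))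
    (valU-stable us π j (λ e e<j → proj₂ (und e e<j)))

  valU-never : ∀ {k} (us : Vec UntilAtom k) π → AlwaysUndecided us π → valU us π 0 ≡ replicate k false
  valU-never []             π und = refl
  valU-never ((a , b) ∷ us) π und = cong₂ _∷_
    (truth-no λ { (d , vd , hb , _) → proj₂ (proj₁ (und d vd)) hb })
    (valU-never us π (λ j vj → proj₂ (und j vj)))

  suffix-valU : ∀ {k} (us : Vec UntilAtom k) π j vj → UndecidedBefore us π j → valU us (suffix π j vj) 0 ≡ valU us π 0
  suffix-valU us π j vj und = trans (valU-agree (suffix-agree π j vj) us) (sym (valU-stable us π j und))

  splice-valU : ∀ {k} (us : Vec UntilAtom k) π j vj ρ eρ → UndecidedBefore us π j →
                valU us (splice π j vj ρ eρ) 0 ≡ valU us ρ 0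
  splice-valU us π j vj ρ eρ und = trans (valU-stable us σ j undσ) (valU-agree (splice-agree π j vj ρ eρ) us)
    where
    σ : Path T
    σ = splice π j vj ρ eρ
    undσ : UndecidedBefore us σ j
    undσ e e<j = subst (AllUndecided us) (sym (splice-prefix π j vj ρ eρ e (<⇒≤ e<j))) (und e e<j)

  decided-value : ∀ π ab c → DecidedAs ab c (seq π 0) → truth (UntilAt π 0 ab) ≡ c
  decided-value π (a , b) true  hb        = truth-yes (0 , InPath-zero (last π) , hb , λ e ())
  decided-value π (a , b) false (na , nb) = truth-no λ
    { (zero  , _ , hb , _)  → nb hb
    ; (suc d , _ , _  , ha) → na (ha 0 (s≤s z≤n)) }

  valU-fix : ∀ {k} (us : Vec UntilAtom (suc k)) i c g π → DecidedAs (lookup us i) c (seq π 0) →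
             g (valU us π 0) ≡ fixAt i c g (valU (removeAt us i) π 0)
  valU-fix us i c g π dec = cong g (begin
    valU us π 0
      ≡⟨ VP.insertAt-removeAt (valU us π 0) i ⟨
    insertAt (removeAt (valU us π 0) i) i (lookup (valU us π 0) i)
      ≡⟨ cong₂ (λ r b → insertAt r i b) (sym (map-removeAt _ us i)) (VP.lookup-map i _ us) ⟩
    insertAt (valU (removeAt us i) π 0) i (truth (UntilAt π 0 (lookup us i)))
      ≡⟨ cong (insertAt _ i) (decided-value π (lookup us i) c dec) ⟩
    insertAt (valU (removeAt us i) π 0) i c ∎)
    where open ≡-Reasoning

  UntilsSpec : ∀ {k} → Vec UntilAtom k → (Vec Bool k → Bool) → Node T → Set
  UntilsSpec us g v = EPath v λ π → IsTrue (g (valU us π 0))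

  -- neverDecided  is witnessed by a path on which all atoms stay undecided,
  -- so that they are all false.
  neverDecided-sem : ∀ {k} (us : Vec UntilAtom k) g v → Sat (neverDecided us g) v → UntilsSpec us g v
  neverDecided-sem {k} us g v s with g (replicate k false) in g-false
  ... | false = ⊥-elim (⊥f-fails v s)
  ... | true with counterexample v (st ⊤f U st (¬s undecided us)) s
  ...   | π , e , nU = π , e , subst IsTrue (sym (trans (cong g (valU-never us π always)) g-false)) tt
    where
    always : AlwaysUndecided us π
    always j vj = dne λ nall → nU (j , z≤n , vj , (λ h → nall (undecided-sem us _ h)) , λ l _ _ → ⊤f-holds _)

  neverDecided-sem⁻ : ∀ {k} (us : Vec UntilAtom k) g v π → seq π 0 ≡ v → IsTrue (g (valU us π 0)) →
                      AlwaysUndecided us π → Sat (neverDecided us g) v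
  neverDecided-sem⁻ {k} us g v π e gt always with g (replicate k false) in g-false
  ... | true  = λ all → let (j , _ , vj , nund , _) = all π e in nund (undecided-sem⁻ us _ (always j vj))
  ... | false = ⊥-elim (subst IsTrue (trans (cong g (valU-never us π always)) g-false) gt)

  mutual
    untils-sem : ∀ k (us : Vec UntilAtom k) g v → Sat (untils k us g) v → UntilsSpec us g v
    untils-sem k us g v (inj₁ s) = someDecided-sem k us g v s
    untils-sem k us g v (inj₂ s) = neverDecided-sem us g v s

    -- Follow the witness of  undecided U decide(...)  up to the decision
    -- point j, then the path provided by the recursive call.
    someDecided-sem : ∀ k (us : Vec UntilAtom k) g v → Sat (someDecided k us g) v → UntilsSpec us g v
    someDecided-sem zero    us g v s = ⊥-elim (⊥f-fails v s)
    someDecided-sem (suc k) us g v s with bigOr-sem (suc k) (firstDecided k us g) v s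
    ... | i , π , e , j , _ , vj , dec , before with decide-sem (lookup us i) (λ c → untils k (removeAt us i) (fixAt i c g)) (seq π j) dec
    ...   | c , hc , rest with untils-sem k (removeAt us i) (fixAt i c g) (seq π j) rest
    ...     | ρ , eρ , gρ = σ , trans (splice-prefix π j vj ρ eρ 0 z≤n) e , subst IsTrue (sym chain) gρ
      where
      σ : Path T
      σ = splice π j vj ρ eρ
      chain : g (valU us σ 0) ≡ fixAt i c g (valU (removeAt us i) ρ 0)
      chain = trans (cong g (splice-valU us π j vj ρ eρ λ l l<j → undecided-sem us _ (before l z≤n l<j)))
                    (valU-fix us i c g ρ (subst (DecidedAs (lookup us i) c) (sym eρ) hc))

  mutual
    untils-sem⁻ : ∀ k (us : Vec UntilAtom k) g v → UntilsSpec us g v → Sat (untils k us g) v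
    untils-sem⁻ k us g v (π , e , gt) with em {Σ ℕ λ j → InPath (last π) j × ¬ AllUndecided us (seq π j)}
    ... | no never = inj₂ (neverDecided-sem⁻ us g v π e gt λ j vj → dne λ nall → never (j , vj , nall))
    ... | yes (j₀ , w₀) with minimize (λ j → InPath (last π) j × ¬ AllUndecided us (seq π j)) j₀ w₀
    ...   | j , (vj , nall) , least = inj₁ (someDecided-sem⁻ k us g v π e gt j vj nall before)
      where
      before : UndecidedBefore us π j
      before l l<j = dne λ nall′ → least l l<j (InPath-mono (last π) (<⇒≤ l<j) vj , nall′)

    -- j is the first position of π where some atom is decided; continue
    -- recursively along the suffix of π from j.
    someDecided-sem⁻ : ∀ k (us : Vec UntilAtom k) g v π → seq π 0 ≡ v → IsTrue (g (valU us π 0)) →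
      ∀ j → InPath (last π) j → ¬ AllUndecided us (seq π j) → UndecidedBefore us π j → Sat (someDecided k us g) v
    someDecided-sem⁻ zero    [] g v π e gt j vj nall before = ⊥-elim (nall tt)
    someDecided-sem⁻ (suc k) us g v π e gt j vj nall before with someDecidedAt us (seq π j) nall
    ... | i , c , hc = bigOr-sem⁻ (suc k) (firstDecided k us g) v i
          (π , e , j , z≤n , vj , decide-sem⁻ (lookup us i) (λ c → untils k (removeAt us i) (fixAt i c g)) (seq π j) c hc rest ,
           λ l _ l<j → undecided-sem⁻ us _ (before l l<j))
      where
      ρ : Path T
      ρ = suffix π j vj
      eρ : seq ρ 0 ≡ seq π j
      eρ = cong (seq π) (+-identityʳ j)
      chain : g (valU us π 0) ≡ fixAt i c g (valU (removeAt us i) ρ 0)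
      chain = trans (cong g (sym (suffix-valU us π j vj before)))
                    (valU-fix us i c g ρ (subst (DecidedAs (lookup us i) c) (sym eρ) hc))
      rest : Sat (untils k (removeAt us i) (fixAt i c g)) (seq π j)
      rest = untils-sem⁻ k (removeAt us i) (fixAt i c g) (seq π j) (ρ , eρ , subst IsTrue chain gt)

  NextUntilsSpec : ∀ {m k} → Vec StateF m → Vec UntilAtom k → (Vec Bool m → Vec Bool k → Bool) → Node T → Set
  NextUntilsSpec xs us g v = EPath v λ π → IsTrue (g (valX xs π 0) (valU us π 0))

  leaf-values : ∀ {m k} (xs : Vec StateF m) (us : Vec UntilAtom k) (g : Vec Bool m → Vec Bool k → Bool) π → ¬ InPath (last π) 1 →
    AllUndecided us (seq π 0) → g (valX xs π 0) (valU us π 0) ≡ g (replicate m false) (replicate k false)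
  leaf-values xs us g π end und = cong₂ g (valX-leaf π end xs) (valU-never us π always)
    where
    always : AlwaysUndecided us π
    always j vj = subst (AllUndecided us ∘ seq π) (sym (endsAt0 π end j vj)) und

  atLeaf-sem : ∀ {m k} (xs : Vec StateF m) (us : Vec UntilAtom k) (g : Vec Bool m → Vec Bool k → Bool) v → AllUndecided us v →
    Sat (atLeaf (g (replicate m false) (replicate k false))) v → NextUntilsSpec xs us g v
  atLeaf-sem xs us g v und (nA , hc) with counterexample v (X (st ⊤f)) nA
  ... | π , e , nX = π , e , subst IsTrue (sym (leaf-values xs us g π end (subst (AllUndecided us) (sym e) und)))
                                (constF-sem _ v hc)
    where
    end : ¬ InPath (last π) 1
    end v1 = nX (v1 , ⊤f-holds _)

  atLeaf-sem⁻ : ∀ {m k} (xs : Vec StateF m) (us : Vec UntilAtom k) (g : Vec Bool m → Vec Bool k → Bool) v π → seq π 0 ≡ v →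
    IsTrue (g (valX xs π 0) (valU us π 0)) → AllUndecided us v → ¬ InPath (last π) 1 →
    Sat (atLeaf (g (replicate m false) (replicate k false))) v
  atLeaf-sem⁻ xs us g v π e gt und end =
    (λ all → end (proj₁ (all π e))) ,
    constF-sem⁻ _ v (subst IsTrue (leaf-values xs us g π end (subst (AllUndecided us) (sym e) und)) gt)

  -- A path through the current node v, all of whose until atoms are
  -- undecided at v, is a step to a successor followed by a path from there.
  moveOn-sem : ∀ {m} k (xs : Vec StateF m) (us : Vec UntilAtom k) g v → AllUndecided us v →
    Sat (moveOn k xs us g) v → NextUntilsSpec xs us g v
  moveOn-sem k xs us g v und (π , e , v1 , s)
    with untils-sem k us (g (valN xs (seq π 1))) (seq π 1) (caseSplit-sem xs _ (seq π 1) s)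
  ... | ρ , eρ , gρ = σ , trans (splice-prefix π 1 v1 ρ eρ 0 z≤n) e , subst IsTrue (sym (cong₂ g nextσ untilσ)) gρ
    where
    σ : Path T
    σ = splice π 1 v1 ρ eρ
    nextσ : valX xs σ 0 ≡ valN xs (seq π 1)
    nextσ = trans (valX-next σ 0 xs (Agree.valid⁻ (splice-agree π 1 v1 ρ eρ) 0 (InPath-zero (last ρ))))
                  (cong (valN xs) (splice-prefix π 1 v1 ρ eρ 1 ≤-refl))
    untilσ : valU us σ 0 ≡ valU us ρ 0
    untilσ = splice-valU us π 1 v1 ρ eρ λ { zero _ → subst (AllUndecided us) (sym e) und ; (suc _) (s≤s ()) }

  moveOn-sem⁻ : ∀ {m} k (xs : Vec StateF m) (us : Vec UntilAtom k) g v π → seq π 0 ≡ v →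
    IsTrue (g (valX xs π 0) (valU us π 0)) → AllUndecided us v → InPath (last π) 1 → Sat (moveOn k xs us g) v
  moveOn-sem⁻ k xs us g v π e gt und v1 =
    π , e , v1 , caseSplit-sem⁻ xs _ (seq π 1)
      (untils-sem⁻ k us _ (seq π 1) (ρ , refl , subst IsTrue (cong₂ g (valX-next π 0 xs v1) untilρ) gt))
    where
    ρ : Path T
    ρ = suffix π 1 v1
    untilρ : valU us π 0 ≡ valU us ρ 0
    untilρ = sym (suffix-valU us π 1 v1 λ { zero _ → subst (AllUndecided us) (sym e) und ; (suc _) (s≤s ()) })

  mutual
    nextUntils-sem : ∀ {m} k (xs : Vec StateF m) (us : Vec UntilAtom k) g v →
                     Sat (nextUntils k xs us g) v → NextUntilsSpec xs us g v
    nextUntils-sem k xs us g v (inj₁ s)                = decidedNow-sem k xs us g v s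
    nextUntils-sem k xs us g v (inj₂ (h , inj₁ leaf)) = atLeaf-sem xs us g v (undecided-sem us v h) leaf
    nextUntils-sem k xs us g v (inj₂ (h , inj₂ next)) = moveOn-sem k xs us g v (undecided-sem us v h) next

    decidedNow-sem : ∀ {m} k (xs : Vec StateF m) (us : Vec UntilAtom k) g v →
                     Sat (decidedNow k xs us g) v → NextUntilsSpec xs us g v
    decidedNow-sem zero    xs us g v s = ⊥-elim (⊥f-fails v s)
    decidedNow-sem (suc k) xs us g v s with bigOr-sem (suc k) (decidedHere k xs us g) v s
    ... | i , d with decide-sem (lookup us i) (λ c → nextUntils k xs (removeAt us i) (λ bx → fixAt i c (g bx))) v d
    ...   | c , hc , rest with nextUntils-sem k xs (removeAt us i) (λ bx → fixAt i c (g bx)) v rest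
    ...     | π , e , gt = π , e ,
              subst IsTrue (sym (valU-fix us i c (g (valX xs π 0)) π (subst (DecidedAs (lookup us i) c) (sym e) hc))) gt

  mutual
    nextUntils-sem⁻ : ∀ {m} k (xs : Vec StateF m) (us : Vec UntilAtom k) g v →
                      NextUntilsSpec xs us g v → Sat (nextUntils k xs us g) v
    nextUntils-sem⁻ k xs us g v (π , e , gt) with em {AllUndecided us v}
    ... | no nall = inj₁ (decidedNow-sem⁻ k xs us g v π e gt nall)
    ... | yes und with em {InPath (last π) 1}
    ...   | no end = inj₂ (undecided-sem⁻ us v und , inj₁ (atLeaf-sem⁻ xs us g v π e gt und end))
    ...   | yes v1 = inj₂ (undecided-sem⁻ us v und , inj₂ (moveOn-sem⁻ k xs us g v π e gt und v1))

    decidedNow-sem⁻ : ∀ {m} k (xs : Vec StateF m) (us : Vec UntilAtom k) g v π → seq π 0 ≡ v →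
      IsTrue (g (valX xs π 0) (valU us π 0)) → ¬ AllUndecided us v → Sat (decidedNow k xs us g) v
    decidedNow-sem⁻ zero    xs [] g v π e gt nall = ⊥-elim (nall tt)
    decidedNow-sem⁻ (suc k) xs us g v π e gt nall with someDecidedAt us v nall
    ... | i , c , hc = bigOr-sem⁻ (suc k) (decidedHere k xs us g) v i
          (decide-sem⁻ (lookup us i) (λ c → nextUntils k xs (removeAt us i) (λ bx → fixAt i c (g bx))) v c hc
            (nextUntils-sem⁻ k xs (removeAt us i) _ v (π , e ,
              subst IsTrue (valU-fix us i c (g (valX xs π 0)) π (subst (DecidedAs (lookup us i) c) (sym e) hc)) gt)))

  evalNF : NF → Path T → Bool
  evalNF c π = combo c (valN (stAtoms c) (seq π 0)) (valX (nxAtoms c) π 0) (valU (unAtoms c) π 0)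

  existsNF-sem : ∀ c v → Sat (existsNF c) v → EPath v (IsTrue ∘ evalNF c)
  existsNF-sem c v s with nextUntils-sem (nu c) (nxAtoms c) (unAtoms c) _ v (caseSplit-sem (stAtoms c) _ v s)
  ... | π , e , gt = π , e , subst (λ w → IsTrue (combo c (valN (stAtoms c) w) _ _)) (sym e) gt

  existsNF-sem⁻ : ∀ c v → EPath v (IsTrue ∘ evalNF c) → Sat (existsNF c) v
  existsNF-sem⁻ c v (π , e , gt) = caseSplit-sem⁻ (stAtoms c) _ v
    (nextUntils-sem⁻ (nu c) (nxAtoms c) (unAtoms c) _ v
      (π , e , subst (λ w → IsTrue (combo c (valN (stAtoms c) w) (valX (nxAtoms c) π 0) (valU (unAtoms c) π 0))) e gt))

-- Correctness of the translation.

module Correctness (em : ExcludedMiddle 0ℓ) (T : Tree) where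
  module S (u : Node T) = Semantics em T u
  open S (troot T) using (dne)

  evalNF-combine : ∀ op c₁ c₂ u π → S.evalNF u (combine op c₁ c₂) π ≡ op (S.evalNF u c₁ π) (S.evalNF u c₂ π)
  evalNF-combine op c₁ c₂ u π = cong₂ op
    (cong₃ (combo c₁) (proj₁ (take-drop-map-++ _ (stAtoms c₁) (stAtoms c₂)))
                      (proj₁ (take-drop-map-++ _ (nxAtoms c₁) (nxAtoms c₂)))
                      (proj₁ (take-drop-map-++ _ (unAtoms c₁) (unAtoms c₂))))
    (cong₃ (combo c₂) (proj₂ (take-drop-map-++ _ (stAtoms c₁) (stAtoms c₂)))
                      (proj₂ (take-drop-map-++ _ (nxAtoms c₁) (nxAtoms c₂)))
                      (proj₂ (take-drop-map-++ _ (unAtoms c₁) (unAtoms c₂))))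

  open Equivalence using (to; from)

  mutual
    tr-correct : ∀ φ (d : IsHCTL+ φ) v u → ⟦ φ ⟧ T v u ⇔ ⟦ tr φ d ⟧ T v u
    tr-correct (atom p)    _           v u = ⇔-id _
    tr-correct (¬s φ)      (¬s d)      v u = ¬-cong-⇔ (tr-correct φ d v u)
    tr-correct (φ ∨s ψ)    (d ∨s e)    v u = tr-correct φ d v u ⊎-⇔ tr-correct ψ e v u
    tr-correct (φ ∧s ψ)    (d ∧s e)    v u = tr-correct φ d v u ×-⇔ tr-correct ψ e v u
    tr-correct (E ψ)       (E d)       v u = mk⇔
      (λ (π , e , s) → S.existsNF-sem⁻ u c v (π , e , to (nf-correct ψ d u π) s))
      (λ s → let (π , e , t) = S.existsNF-sem u c v s in π , e , from (nf-correct ψ d u π) t)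
      where
      c : NF
      c = normalForm ψ d
    tr-correct (A ψ)       (A d)       v u = mk⇔
      (λ all s → let (π , e , t) = S.existsNF-sem u (negNF c) v s in
                 to IsTrue-not t (to (nf-correct ψ d u π) (all π e)))
      (λ ns π e → dne λ nψ →
                 ns (S.existsNF-sem⁻ u (negNF c) v (π , e , from IsTrue-not (nψ ∘ from (nf-correct ψ d u π)))))
      where
      c : NF
      c = normalForm ψ d
    tr-correct (↓x φ)      (↓x d)      v u = tr-correct φ d v v
    tr-correct var-x       _           v u = ⇔-id _
    tr-correct (at-x φ)    (at-x d)    v u = tr-correct φ d u u
    tr-correct root        _           v u = ⇔-id _
    tr-correct (at-root φ) (at-root d) v u = tr-correct φ d (troot T) u

    nf-correct : ∀ ψ (d : IsHCTL+Path ψ) u π → ⟦ ψ ⟧P T π 0 u ⇔ IsTrue (S.evalNF u (normalForm ψ d) π)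
    nf-correct (st φ)        (st d)   u π = S.truth-⇔ u (tr-correct φ d (seq π 0) u)
    nf-correct (¬p ψ)        (¬p d)   u π = ⇔-sym IsTrue-not ⇔-∘ ¬-cong-⇔ (nf-correct ψ d u π)
    nf-correct (ψ ∨p χ)      (d ∨p e) u π = subst (λ b → _ ⇔ IsTrue b) (sym (evalNF-combine _∨_ (normalForm ψ d) (normalForm χ e) u π))
      (⇔-sym T-∨ ⇔-∘ (nf-correct ψ d u π ⊎-⇔ nf-correct χ e u π))
    nf-correct (ψ ∧p χ)      (d ∧p e) u π = subst (λ b → _ ⇔ IsTrue b) (sym (evalNF-combine _∧_ (normalForm ψ d) (normalForm χ e) u π))
      (⇔-sym T-∧ ⇔-∘ (nf-correct ψ d u π ×-⇔ nf-correct χ e u π))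
    nf-correct (X (st φ))    (X d)    u π = S.truth-⇔ u (⇔-id _ ×-⇔ tr-correct φ d (seq π 1) u)
    nf-correct (st a U st b) (d U e)  u π = S.truth-⇔ u (mk⇔
      (λ (j , _ , vj , hb , ha) → j , vj , to (tr-correct b e (seq π j) u) hb ,
                                  λ l l<j → to (tr-correct a d (seq π l) u) (ha l z≤n l<j))
      (λ (j , vj , hb , ha) → j , z≤n , vj , from (tr-correct b e (seq π j) u) hb ,
                              λ l _ l<j → from (tr-correct a d (seq π l) u) (ha l l<j)))

-- The translation lands in HCTL_1.

HCTLAtom : UntilAtom → Set
HCTLAtom (a , b) = IsHCTL a × IsHCTL b

All-removeAt : ∀ {A : Set} {P : A → Set} {k} {xs : Vec A (suc k)} → All P xs → ∀ i → All P (removeAt xs i)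
All-removeAt (px ∷ pxs)       zero    = pxs
All-removeAt (px ∷ py ∷ pxs) (suc i) = px ∷ All-removeAt (py ∷ pxs) i

⊤f-HCTL : IsHCTL ⊤f
⊤f-HCTL = root ∨s (¬s root)

⊥f-HCTL : IsHCTL ⊥f
⊥f-HCTL = ¬s ⊤f-HCTL

constF-HCTL : ∀ c → IsHCTL (constF c)
constF-HCTL true  = ⊤f-HCTL
constF-HCTL false = ⊥f-HCTL

undecided-HCTL : ∀ {k} {us : Vec UntilAtom k} → All HCTLAtom us → IsHCTL (undecided us)
undecided-HCTL []                  = ⊤f-HCTL
undecided-HCTL ((ha , hb) ∷ hs) = (ha ∧s (¬s hb)) ∧s undecided-HCTL hs

bigOr-HCTL : ∀ n {f : Fin n → StateF} → (∀ i → IsHCTL (f i)) → IsHCTL (bigOr n f)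
bigOr-HCTL zero    h = ⊥f-HCTL
bigOr-HCTL (suc n) h = h zero ∨s bigOr-HCTL n (h ∘ suc)

decide-HCTL : ∀ {ab R} → HCTLAtom ab → (∀ c → IsHCTL (R c)) → IsHCTL (decide ab R)
decide-HCTL (ha , hb) h = (hb ∧s h true) ∨s (((¬s ha) ∧s (¬s hb)) ∧s h false)

caseSplit-HCTL : ∀ {n} {ss : Vec StateF n} {F} → All IsHCTL ss → (∀ bs → IsHCTL (F bs)) → IsHCTL (caseSplit ss F)
caseSplit-HCTL []       h = h []
caseSplit-HCTL (p ∷ ps) h = (p ∧s caseSplit-HCTL ps (h ∘ (true ∷_))) ∨s ((¬s p) ∧s caseSplit-HCTL ps (h ∘ (false ∷_)))

neverDecided-HCTL : ∀ {k} (us : Vec UntilAtom k) g → All HCTLAtom us → IsHCTL (neverDecided us g)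
neverDecided-HCTL {k} us g hs with g (replicate k false)
... | true  = ¬s A (⊤f-HCTL U (¬s undecided-HCTL hs))
... | false = ⊥f-HCTL

untils-HCTL : ∀ k (us : Vec UntilAtom k) g → All HCTLAtom us → IsHCTL (untils k us g)
untils-HCTL zero    us g hs = ⊥f-HCTL ∨s neverDecided-HCTL us g hs
untils-HCTL (suc k) us g hs = bigOr-HCTL (suc k) (λ i →
    E (undecided-HCTL hs U decide-HCTL (All.lookup⁺ hs i) λ c → untils-HCTL k (removeAt us i) (fixAt i c g) (All-removeAt hs i)))
  ∨s neverDecided-HCTL us g hs

atLeaf-HCTL : ∀ c → IsHCTL (atLeaf c)
atLeaf-HCTL c = (¬s A (X ⊤f-HCTL)) ∧s constF-HCTL c

moveOn-HCTL : ∀ {m} k (xs : Vec StateF m) (us : Vec UntilAtom k) g → All IsHCTL xs → All HCTLAtom us →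
              IsHCTL (moveOn k xs us g)
moveOn-HCTL k xs us g hx hs = E (X (caseSplit-HCTL hx λ bx → untils-HCTL k us (g bx) hs))

nextUntils-HCTL : ∀ {m} k (xs : Vec StateF m) (us : Vec UntilAtom k) g → All IsHCTL xs → All HCTLAtom us →
                  IsHCTL (nextUntils k xs us g)
nextUntils-HCTL zero    xs us g hx hs =
  ⊥f-HCTL ∨s (undecided-HCTL hs ∧s (atLeaf-HCTL _ ∨s moveOn-HCTL zero xs us g hx hs))
nextUntils-HCTL (suc k) xs us g hx hs =
  bigOr-HCTL (suc k) (λ i → decide-HCTL (All.lookup⁺ hs i) λ c →
                              nextUntils-HCTL k xs (removeAt us i) (λ bx → fixAt i c (g bx)) hx (All-removeAt hs i))
  ∨s (undecided-HCTL hs ∧s (atLeaf-HCTL _ ∨s moveOn-HCTL (suc k) xs us g hx hs))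

HCTLAtoms : NF → Set
HCTLAtoms c = All IsHCTL (stAtoms c) × All IsHCTL (nxAtoms c) × All HCTLAtom (unAtoms c)

existsNF-HCTL : ∀ c → HCTLAtoms c → IsHCTL (existsNF c)
existsNF-HCTL c (hs , hx , hu) = caseSplit-HCTL hs λ bs → nextUntils-HCTL (nu c) (nxAtoms c) (unAtoms c) _ hx hu

combine-HCTL : ∀ op c₁ c₂ → HCTLAtoms c₁ → HCTLAtoms c₂ → HCTLAtoms (combine op c₁ c₂)
combine-HCTL op c₁ c₂ (s₁ , x₁ , u₁) (s₂ , x₂ , u₂) = All.++⁺ s₁ s₂ , All.++⁺ x₁ x₂ , All.++⁺ u₁ u₂

mutual
  tr-HCTL : ∀ φ (d : IsHCTL+ φ) → IsHCTL (tr φ d)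
  tr-HCTL (atom p)    _           = atom p
  tr-HCTL (¬s φ)      (¬s d)      = ¬s tr-HCTL φ d
  tr-HCTL (φ ∨s ψ)    (d ∨s e)    = tr-HCTL φ d ∨s tr-HCTL ψ e
  tr-HCTL (φ ∧s ψ)    (d ∧s e)    = tr-HCTL φ d ∧s tr-HCTL ψ e
  tr-HCTL (E ψ)       (E d)       = existsNF-HCTL (normalForm ψ d) (normalForm-HCTL ψ d)
  tr-HCTL (A ψ)       (A d)       = ¬s existsNF-HCTL (negNF (normalForm ψ d)) (normalForm-HCTL ψ d)
  tr-HCTL (↓x φ)      (↓x d)      = ↓x (tr-HCTL φ d)
  tr-HCTL var-x       _           = var-x
  tr-HCTL (at-x φ)    (at-x d)    = at-x (tr-HCTL φ d)
  tr-HCTL root        _           = root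
  tr-HCTL (at-root φ) (at-root d) = at-root (tr-HCTL φ d)

  normalForm-HCTL : ∀ ψ (d : IsHCTL+Path ψ) → HCTLAtoms (normalForm ψ d)
  normalForm-HCTL (st φ)        (st d)   = tr-HCTL φ d ∷ [] , [] , []
  normalForm-HCTL (¬p ψ)        (¬p d)   = normalForm-HCTL ψ d
  normalForm-HCTL (ψ ∨p χ)      (d ∨p e) = combine-HCTL _∨_ (normalForm ψ d) (normalForm χ e) (normalForm-HCTL ψ d) (normalForm-HCTL χ e)
  normalForm-HCTL (ψ ∧p χ)      (d ∧p e) = combine-HCTL _∧_ (normalForm ψ d) (normalForm χ e) (normalForm-HCTL ψ d) (normalForm-HCTL χ e)
  normalForm-HCTL (X (st φ))    (X d)    = [] , tr-HCTL φ d ∷ [] , []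
  normalForm-HCTL (st a U st b) (d U e)  = [] , [] , (tr-HCTL a d , tr-HCTL b e) ∷ []

open ≤-Reasoning

≤-by : ∀ {a b} c → a + c ≡ b → a ≤ b
≤-by {a} c eq = subst (a ≤_) eq (m≤m+n a c)

weight : ∀ {A : Set} {n} → (A → ℕ) → Vec A n → ℕ
weight f xs = V.sum (V.map f xs)

weight-++ : ∀ {A : Set} {m n} (f : A → ℕ) (xs : Vec A m) (ys : Vec A n) →
            weight f (xs ++ ys) ≡ weight f xs + weight f ys
weight-++ f xs ys = trans (cong V.sum (VP.map-++ f xs ys)) (VP.sum-++ (V.map f xs))

weight-lookup : ∀ {A : Set} {n} (f : A → ℕ) (xs : Vec A n) i → f (lookup xs i) ≤ weight f xs
weight-lookup f (x ∷ xs) zero    = m≤m+n _ _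
weight-lookup f (x ∷ xs) (suc i) = ≤-trans (weight-lookup f xs i) (m≤n+m _ _)

weight-removeAt : ∀ {A : Set} {n} (f : A → ℕ) (xs : Vec A (suc n)) i → weight f (removeAt xs i) ≤ weight f xs
weight-removeAt f (x ∷ xs)     zero    = m≤n+m _ _
weight-removeAt f (x ∷ y ∷ xs) (suc i) = +-monoʳ-≤ (f x) (weight-removeAt f (y ∷ xs) i)

-- Each atom is charged its size plus a constant paying for the
-- connectives the building blocks put around it.
wS : ∀ {n} → Vec StateF n → ℕ
wS = weight λ s → size s + 10

wAtom : UntilAtom → ℕ
wAtom (a , b) = size a + size b + 10

wU : ∀ {k} → Vec UntilAtom k → ℕ
wU = weight wAtom

size-constF : ∀ c → size (constF c) ≤ 5
size-constF true  = n≤1+n 4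
size-constF false = ≤-refl

size-undecided : ∀ {k} (us : Vec UntilAtom k) → size (undecided us) ≤ wU us + 4
size-undecided []             = ≤-refl
size-undecided ((a , b) ∷ us) = begin
  size (undecided ((a , b) ∷ us))           ≡⟨ shape (size a) (size b) (size (undecided us)) ⟩
  (size a + size b + 3) + size (undecided us) ≤⟨ +-mono-≤ (+-monoʳ-≤ (size a + size b) (≤-by 7 refl)) (size-undecided us) ⟩
  (size a + size b + 10) + (wU us + 4)       ≡⟨ +-assoc (size a + size b + 10) (wU us) 4 ⟨
  size a + size b + 10 + wU us + 4           ∎
  where
  shape : ∀ p q r → suc (suc (p + suc q) + r) ≡ p + q + 3 + r
  shape = solve-∀

size-neverDecided : ∀ {k} (us : Vec UntilAtom k) g → size (neverDecided us g) ≤ wU us + 12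
size-neverDecided {k} us g with g (replicate k false)
... | true  = ≤-trans (+-monoʳ-≤ 8 (size-undecided us)) (≤-reflexive (shape (wU us)))
  where
  shape : ∀ w → 8 + (w + 4) ≡ w + 12
  shape = solve-∀
... | false = ≤-trans (≤-by 7 refl) (m≤n+m 12 (wU us))

size-bigOr : ∀ n f B → (∀ i → suc (size (f i)) ≤ B) → size (bigOr n f) ≤ n * B + 5
size-bigOr zero    f B h = ≤-refl
size-bigOr (suc n) f B h = begin
  suc (size (f zero) + size (bigOr n (f ∘ suc))) ≤⟨ +-mono-≤ (h zero) (size-bigOr n (f ∘ suc) B (h ∘ suc)) ⟩
  B + (n * B + 5)                                ≡⟨ +-assoc B (n * B) 5 ⟨
  suc n * B + 5                                  ∎

size-decide : ∀ ab (R : Bool → StateF) Y → (∀ c → size (R c) ≤ Y) → size (decide ab R) ≤ 2 * wAtom ab + 2 * Y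
size-decide (a , b) R Y hR = begin
  size (decide (a , b) R)
    ≡⟨ shape (size a) (size b) (size (R true)) (size (R false)) ⟩
  (size a + 2 * size b + 6) + (size (R true) + size (R false))
    ≤⟨ +-mono-≤ (≤-by {size a + 2 * size b + 6} (size a + 14) (slack (size a) (size b))) (+-mono-≤ (hR true) (hR false)) ⟩
  2 * (size a + size b + 10) + (Y + Y)
    ≡⟨ cong (2 * (size a + size b + 10) +_) (double Y) ⟩
  2 * (size a + size b + 10) + 2 * Y ∎
  where
  shape : ∀ p q r s → suc (suc (q + r) + suc (suc (suc p + suc q) + s)) ≡ p + 2 * q + 6 + (r + s)
  shape = solve-∀
  slack : ∀ p q → p + 2 * q + 6 + (p + 14) ≡ 2 * (p + q + 10)
  slack = solve-∀
  double : ∀ y → y + y ≡ 2 * y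
  double = solve-∀

size-nextUntils-split : ∀ {m} k (xs : Vec StateF m) (us : Vec UntilAtom k) g →
  size (nextUntils k xs us g) ≤ size (decidedNow k xs us g) + size (caseSplit xs λ bx → untils k us (g bx)) + (wU us + 22)
size-nextUntils-split {m} k xs us g = begin
  size (nextUntils k xs us g)
    ≡⟨ shape D S G C ⟩
  D + S + (G + C + 13)
    ≤⟨ +-monoʳ-≤ (D + S) (+-monoˡ-≤ 13 (+-mono-≤ (size-undecided us) (size-constF _))) ⟩
  D + S + (wU us + 4 + 5 + 13)
    ≡⟨ cong (D + S +_) (constants (wU us)) ⟩
  D + S + (wU us + 22) ∎
  where
  D S G C : ℕ
  D = size (decidedNow k xs us g)
  S = size (caseSplit xs λ bx → untils k us (g bx))
  G = size (undecided us)
  C = size (constF (g (replicate m false) (replicate k false)))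
  constants : ∀ w → w + 4 + 5 + 13 ≡ w + 22
  constants = solve-∀
  shape : ∀ D S G C → suc (D + suc (G + suc (suc (7 + C) + suc (suc S)))) ≡ D + S + (G + C + 13)
  shape = solve-∀

natoms : NF → ℕ
natoms c = ns c + nx c + nu c

wt : NF → ℕ
wt c = wS (stAtoms c) + wS (nxAtoms c) + wU (unAtoms c)

natoms-combine : ∀ op c₁ c₂ → natoms (combine op c₁ c₂) ≡ natoms c₁ + natoms c₂
natoms-combine op c₁ c₂ = regroup (ns c₁) (ns c₂) (nx c₁) (nx c₂) (nu c₁) (nu c₂)
  where
  regroup : ∀ a b c d e f → a + b + (c + d) + (e + f) ≡ a + c + e + (b + d + f)
  regroup = solve-∀

wt-combine : ∀ op c₁ c₂ → wt (combine op c₁ c₂) ≡ wt c₁ + wt c₂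
wt-combine op c₁ c₂ = trans
  (cong₃ (λ a b c → a + b + c) (weight-++ _ (stAtoms c₁) (stAtoms c₂)) (weight-++ _ (nxAtoms c₁) (nxAtoms c₂))
                               (weight-++ wAtom (unAtoms c₁) (unAtoms c₂)))
  (regroup (wS (stAtoms c₁)) (wS (stAtoms c₂)) (wS (nxAtoms c₁)) (wS (nxAtoms c₂)) (wU (unAtoms c₁)) (wU (unAtoms c₂)))
  where
  regroup : ∀ a b c d e f → a + b + (c + d) + (e + f) ≡ a + c + e + (b + d + f)
  regroup = solve-∀

size-pos : ∀ φ → 1 ≤ size φ
size-pos (atom _)    = s≤s z≤n
size-pos (¬s _)      = s≤s z≤n
size-pos (_ ∨s _)    = s≤s z≤n
size-pos (_ ∧s _)    = s≤s z≤n
size-pos (E _)       = s≤s z≤n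
size-pos (A _)       = s≤s z≤n
size-pos (↓x _)      = s≤s z≤n
size-pos var-x       = s≤s z≤n
size-pos (at-x _)    = s≤s z≤n
size-pos root        = s≤s z≤n
size-pos (at-root _) = s≤s z≤n

natoms≤size : ∀ ψ (d : IsHCTL+Path ψ) → natoms (normalForm ψ d) ≤ sizeP ψ
natoms≤size (st φ)        (st d)   = size-pos φ
natoms≤size (¬p ψ)        (¬p d)   = ≤-trans (natoms≤size ψ d) (n≤1+n _)
natoms≤size (ψ ∨p χ)      (d ∨p e) = subst (_≤ sizeP (ψ ∨p χ)) (sym (natoms-combine _∨_ (normalForm ψ d) (normalForm χ e)))
  (≤-trans (+-mono-≤ (natoms≤size ψ d) (natoms≤size χ e)) (n≤1+n _))
natoms≤size (ψ ∧p χ)      (d ∧p e) = subst (_≤ sizeP (ψ ∧p χ)) (sym (natoms-combine _∧_ (normalForm ψ d) (normalForm χ e)))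
  (≤-trans (+-mono-≤ (natoms≤size ψ d) (natoms≤size χ e)) (n≤1+n _))
natoms≤size (X (st φ))    (X d)    = s≤s z≤n
natoms≤size (st a U st b) (d U e)  = s≤s z≤n

10≤wt : ∀ ψ (d : IsHCTL+Path ψ) → 10 ≤ wt (normalForm ψ d)
10≤wt (st φ)        (st d)   = ≤-trans (m≤n+m 10 _) (≤-trans (m≤m+n _ 0) (≤-trans (m≤m+n _ 0) (m≤m+n _ 0)))
10≤wt (¬p ψ)        (¬p d)   = 10≤wt ψ d
10≤wt (ψ ∨p χ)      (d ∨p e) = subst (10 ≤_) (sym (wt-combine _∨_ (normalForm ψ d) (normalForm χ e)))
  (≤-trans (10≤wt ψ d) (m≤m+n _ _))
10≤wt (ψ ∧p χ)      (d ∧p e) = subst (10 ≤_) (sym (wt-combine _∧_ (normalForm ψ d) (normalForm χ e)))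
  (≤-trans (10≤wt ψ d) (m≤m+n _ _))
10≤wt (X (st φ))    (X d)    = ≤-trans (m≤n+m 10 _) (≤-trans (m≤m+n _ 0) (m≤m+n _ 0))
10≤wt (st a U st b) (d U e)  = ≤-trans (m≤n+m 10 _) (m≤m+n _ 0)

-- Size of the translation.

-- Sizes are bounded by  x ^ e * W  for a base x that is large compared
-- with the number of until atoms, and a weight W of the atoms.
module SizeBound (x : ℕ) (12≤x : 12 ≤ x) where
  instance
    x-nonZero : NonZero x
    x-nonZero = >-nonZero (≤-trans (s≤s z≤n) 12≤x)

  ≤-pow* : ∀ e W → W ≤ x ^ e * W
  ≤-pow* e W = subst (_≤ x ^ e * W) (*-identityˡ W) (*-monoˡ-≤ W (m^n>0 x e))

  x*pow* : ∀ e W → x * (x ^ e * W) ≡ x ^ suc e * W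
  x*pow* e W = sym (*-assoc x (x ^ e) W)

  pow*-merge : ∀ e f W → x ^ e * (x ^ f * W) ≡ x ^ (e + f) * W
  pow*-merge e f W = trans (sym (*-assoc (x ^ e) (x ^ f) W)) (cong (_* W) (sym (^-distribˡ-+-* x e f)))

  absorb : ∀ k W Y → W ≤ Y → 6 * suc (suc k) ≤ x → suc k * (5 * Y) + W + Y ≤ x * Y
  absorb k W Y W≤Y hx = begin
    suc k * (5 * Y) + W + Y ≤⟨ +-monoˡ-≤ Y (+-monoʳ-≤ (suc k * (5 * Y)) W≤Y) ⟩
    suc k * (5 * Y) + Y + Y ≡⟨ collect k Y ⟩
    (5 * k + 7) * Y         ≤⟨ *-monoˡ-≤ Y (≤-trans (≤-by {5 * k + 7} (k + 5) (slack k)) hx) ⟩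
    x * Y                   ∎
    where
    collect : ∀ k Y → suc k * (5 * Y) + Y + Y ≡ (5 * k + 7) * Y
    collect = solve-∀
    slack : ∀ k → 5 * k + 7 + (k + 5) ≡ 6 * suc (suc k)
    slack = solve-∀

  size-caseSplit : ∀ {n} (ss : Vec StateF n) F Y → (∀ bs → size (F bs) ≤ Y) → wS ss ≤ Y →
                   size (caseSplit ss F) ≤ x ^ n * Y
  size-caseSplit []               F Y hF hw = ≤-trans (hF []) (≤-pow* 0 Y)
  size-caseSplit {suc n} (s ∷ ss) F Y hF hw = begin
    size (caseSplit (s ∷ ss) F)
      ≡⟨ shape (size s) (size (branch true)) (size (branch false)) ⟩
    2 * (size s + 2) + (size (branch true) + size (branch false))
      ≤⟨ +-mono-≤ (*-monoʳ-≤ 2 s≤Z) (+-mono-≤ (rec true) (rec false)) ⟩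
    2 * Z + (Z + Z) ≡⟨ collect Z ⟩
    4 * Z           ≤⟨ *-monoˡ-≤ Z (≤-trans (≤-by {4} 8 refl) 12≤x) ⟩
    x * Z           ≡⟨ x*pow* n Y ⟩
    x ^ suc n * Y   ∎
    where
    Z : ℕ
    Z = x ^ n * Y
    branch : Bool → StateF
    branch c = caseSplit ss (F ∘ (c ∷_))
    rec : ∀ c → size (branch c) ≤ Z
    rec c = size-caseSplit ss (F ∘ (c ∷_)) Y (hF ∘ (c ∷_)) (≤-trans (m≤n+m (wS ss) (size s + 10)) hw)
    s≤Z : size s + 2 ≤ Z
    s≤Z = ≤-trans (+-monoʳ-≤ (size s) (≤-by 8 refl)) (≤-trans (m≤m+n _ (wS ss)) (≤-trans hw (≤-pow* n Y)))
    shape : ∀ s a b → suc (suc (s + a) + suc (suc s + b)) ≡ 2 * (s + 2) + (a + b)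
    shape = solve-∀
    collect : ∀ Z → 2 * Z + (Z + Z) ≡ 4 * Z
    collect = solve-∀

  firstDecided-bound : ∀ k (us : Vec UntilAtom (suc k)) g W Y → wU us + 20 ≤ W → W ≤ Y →
    (∀ i c → size (untils k (removeAt us i) (fixAt i c g)) ≤ Y) → ∀ i → suc (size (firstDecided k us g i)) ≤ 5 * Y
  firstDecided-bound k us g W Y hW W≤Y hR i = begin
    3 + (size (undecided us) + size D)
      ≤⟨ +-monoʳ-≤ 3 (+-mono-≤ (size-undecided us) (size-decide (lookup us i) (λ c → untils k (removeAt us i) (fixAt i c g)) Y (hR i))) ⟩
    3 + ((w + 4) + (2 * wAtom (lookup us i) + 2 * Y))
      ≤⟨ +-monoʳ-≤ 3 (+-monoʳ-≤ (w + 4) (+-monoˡ-≤ (2 * Y) (*-monoʳ-≤ 2 (weight-lookup wAtom us i)))) ⟩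
    3 + ((w + 4) + (2 * w + 2 * Y)) ≤⟨ ≤-by 53 (slack w Y) ⟩
    3 * (w + 20) + 2 * Y            ≤⟨ +-monoˡ-≤ (2 * Y) (*-monoʳ-≤ 3 (≤-trans hW W≤Y)) ⟩
    3 * Y + 2 * Y                   ≡⟨ collect Y ⟩
    5 * Y                           ∎
    where
    w : ℕ
    w = wU us
    D : StateF
    D = decide (lookup us i) λ c → untils k (removeAt us i) (fixAt i c g)
    slack : ∀ w Y → 3 + ((w + 4) + (2 * w + 2 * Y)) + 53 ≡ 3 * (w + 20) + 2 * Y
    slack = solve-∀
    collect : ∀ Y → 3 * Y + 2 * Y ≡ 5 * Y
    collect = solve-∀

  -- With k until atoms,  untils  has size at most x ^ (k + 1) * W:
  -- k choices of the first decided atom, each followed by k - 1 atoms.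
  size-untils : ∀ k (us : Vec UntilAtom k) g W → wU us + 20 ≤ W → 6 * suc k ≤ x →
                size (untils k us g) ≤ x ^ suc k * W
  size-untils zero us g W hW hx = begin
    6 + size (neverDecided us g) ≤⟨ +-monoʳ-≤ 6 (size-neverDecided us g) ⟩
    6 + (wU us + 12)             ≤⟨ ≤-by 2 (slack (wU us)) ⟩
    wU us + 20                   ≤⟨ hW ⟩
    W                            ≤⟨ ≤-pow* 1 W ⟩
    x ^ 1 * W                    ∎
    where
    slack : ∀ w → 6 + (w + 12) + 2 ≡ w + 20
    slack = solve-∀
  size-untils (suc k) us g W hW hx = begin
    suc (size (someDecided (suc k) us g) + size (neverDecided us g))
      ≤⟨ s≤s (+-mono-≤ (size-bigOr (suc k) (firstDecided k us g) (5 * Y)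
                          (firstDecided-bound k us g W Y hW (≤-pow* (suc k) W) rec))
                        (size-neverDecided us g)) ⟩
    suc (suc k * (5 * Y) + 5 + (wU us + 12)) ≤⟨ ≤-by (2 + Y) (slack (suc k * (5 * Y)) (wU us) Y) ⟩
    suc k * (5 * Y) + (wU us + 20) + Y       ≤⟨ +-monoˡ-≤ Y (+-monoʳ-≤ (suc k * (5 * Y)) hW) ⟩
    suc k * (5 * Y) + W + Y                  ≤⟨ absorb k W Y (≤-pow* (suc k) W) hx ⟩
    x * Y                                    ≡⟨ x*pow* (suc k) W ⟩
    x ^ suc (suc k) * W                      ∎
    where
    Y : ℕ
    Y = x ^ suc k * W
    rec : ∀ i c → size (untils k (removeAt us i) (fixAt i c g)) ≤ Y
    rec i c = size-untils k (removeAt us i) (fixAt i c g) W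
      (≤-trans (+-monoˡ-≤ 20 (weight-removeAt wAtom us i)) hW) (≤-trans (*-monoʳ-≤ 6 (n≤1+n (suc k))) hx)
    slack : ∀ a w Y → suc (a + 5 + (w + 12)) + (2 + Y) ≡ a + (w + 20) + Y
    slack = solve-∀

  decide-bound : ∀ ab (R : Bool → StateF) W Y → (∀ c → size (R c) ≤ Y) → wAtom ab ≤ W → 1 ≤ W → W ≤ Y →
                 suc (size (decide ab R)) ≤ 5 * Y
  decide-bound ab R W Y hR hw 1≤W W≤Y = begin
    suc (size (decide ab R))  ≤⟨ s≤s (size-decide ab R Y hR) ⟩
    suc (2 * wAtom ab + 2 * Y) ≤⟨ s≤s (+-monoˡ-≤ (2 * Y) (*-monoʳ-≤ 2 hw)) ⟩
    1 + (2 * W + 2 * Y)       ≤⟨ +-mono-≤ (≤-trans 1≤W W≤Y) (+-monoˡ-≤ (2 * Y) (*-monoʳ-≤ 2 W≤Y)) ⟩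
    Y + (2 * Y + 2 * Y)       ≡⟨ collect Y ⟩
    5 * Y                     ∎
    where
    collect : ∀ Y → Y + (2 * Y + 2 * Y) ≡ 5 * Y
    collect = solve-∀

  size-continuation : ∀ {m} k (xs : Vec StateF m) (us : Vec UntilAtom k) (g : Vec Bool m → Vec Bool k → Bool) W → wS xs + wU us + 30 ≤ W →
    6 * suc k ≤ x → size (caseSplit xs λ bx → untils k us (g bx)) ≤ x ^ (1 + k + m) * W
  size-continuation {m} k xs us g W hW hx = begin
    size (caseSplit xs λ bx → untils k us (g bx))
      ≤⟨ size-caseSplit xs (λ bx → untils k us (g bx)) (x ^ suc k * W) (λ bx → size-untils k us (g bx) W hU hx)
                        (≤-trans (≤-trans (≤-trans (m≤m+n _ _) (m≤m+n _ 30)) hW) (≤-pow* (suc k) W)) ⟩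
    x ^ m * (x ^ suc k * W) ≡⟨ pow*-merge m (suc k) W ⟩
    x ^ (m + suc k) * W     ≡⟨ cong (λ e → x ^ e * W) (swap m k) ⟩
    x ^ (1 + k + m) * W     ∎
    where
    hU : wU us + 20 ≤ W
    hU = ≤-trans (≤-by (wS xs + 10) (slack (wS xs) (wU us))) hW
      where
      slack : ∀ s u → u + 20 + (s + 10) ≡ s + u + 30
      slack = solve-∀
    swap : ∀ m k → m + suc k ≡ 1 + k + m
    swap = solve-∀

  size-nextUntils : ∀ {m} k (xs : Vec StateF m) (us : Vec UntilAtom k) g W → wS xs + wU us + 30 ≤ W →
                    6 * suc k ≤ x → size (nextUntils k xs us g) ≤ x ^ (2 + k + m) * W
  size-nextUntils {m} zero xs us g W hW hx = begin
    size (nextUntils zero xs us g) ≤⟨ size-nextUntils-split zero xs us g ⟩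
    5 + S + (wU us + 22)           ≤⟨ +-monoˡ-≤ (wU us + 22) (+-monoʳ-≤ 5 (size-continuation zero xs us g W hW hx)) ⟩
    5 + Z + (wU us + 22)           ≤⟨ ≤-by (wS xs + 3) (slack Z (wU us) (wS xs)) ⟩
    Z + (wS xs + wU us + 30)       ≤⟨ +-monoʳ-≤ Z (≤-trans hW (≤-pow* (1 + m) W)) ⟩
    Z + Z                          ≡⟨ double Z ⟩
    2 * Z                          ≤⟨ *-monoˡ-≤ Z (≤-trans (≤-by {2} 10 refl) 12≤x) ⟩
    x * Z                          ≡⟨ x*pow* (1 + m) W ⟩
    x ^ (2 + m) * W                ∎
    where
    S Z : ℕ
    S = size (caseSplit xs λ bx → untils zero us (g bx))
    Z = x ^ (1 + m) * W
    slack : ∀ Z u s → 5 + Z + (u + 22) + (s + 3) ≡ Z + (s + u + 30)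
    slack = solve-∀
    double : ∀ Z → Z + Z ≡ 2 * Z
    double = solve-∀
  size-nextUntils {m} (suc k) xs us g W hW hx = begin
    size (nextUntils (suc k) xs us g)
      ≤⟨ size-nextUntils-split (suc k) xs us g ⟩
    size (decidedNow (suc k) xs us g) + size (caseSplit xs λ bx → untils (suc k) us (g bx)) + (wU us + 22)
      ≤⟨ +-monoˡ-≤ (wU us + 22) (+-mono-≤ decidedNow-bound (size-continuation (suc k) xs us g W hW hx)) ⟩
    suc k * (5 * Y) + 5 + Y + (wU us + 22) ≤⟨ ≤-by (wS xs + 3) (slack (suc k * (5 * Y)) Y (wU us) (wS xs)) ⟩
    suc k * (5 * Y) + (wS xs + wU us + 30) + Y ≤⟨ +-monoˡ-≤ Y (+-monoʳ-≤ (suc k * (5 * Y)) hW) ⟩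
    suc k * (5 * Y) + W + Y                ≤⟨ absorb k W Y (≤-pow* (2 + k + m) W) hx ⟩
    x * Y                                  ≡⟨ x*pow* (2 + k + m) W ⟩
    x ^ (2 + suc k + m) * W                ∎
    where
    Y : ℕ
    Y = x ^ (2 + k + m) * W
    weights : ∀ i → wS xs + wU (removeAt us i) + 30 ≤ W
    weights i = ≤-trans (+-monoˡ-≤ 30 (+-monoʳ-≤ (wS xs) (weight-removeAt wAtom us i))) hW
    atom≤W : ∀ i → wAtom (lookup us i) ≤ W
    atom≤W i = ≤-trans (weight-lookup wAtom us i) (≤-trans (≤-trans (m≤n+m _ (wS xs)) (m≤m+n _ 30)) hW)
    1≤W : 1 ≤ W
    1≤W = ≤-trans (≤-trans (≤-by {1} 29 refl) (m≤n+m 30 _)) hW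
    decidedNow-bound : size (decidedNow (suc k) xs us g) ≤ suc k * (5 * Y) + 5
    decidedNow-bound = size-bigOr (suc k) (decidedHere k xs us g) (5 * Y) λ i →
      decide-bound (lookup us i) (λ c → nextUntils k xs (removeAt us i) (λ bx → fixAt i c (g bx))) W Y
        (λ c → size-nextUntils k xs (removeAt us i) (λ bx → fixAt i c (g bx)) W (weights i)
                 (≤-trans (*-monoʳ-≤ 6 (n≤1+n (suc k))) hx))
        (atom≤W i) 1≤W (≤-pow* (2 + k + m) W)
    slack : ∀ a Y u s → a + 5 + Y + (u + 22) + (s + 3) ≡ a + (s + u + 30) + Y
    slack = solve-∀

  size-existsNF : ∀ c → 6 * suc (nu c) ≤ x → size (existsNF c) ≤ x ^ (ns c + (2 + nu c + nx c)) * (wt c + 30)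
  size-existsNF c hx = begin
    size (existsNF c)
      ≤⟨ size-caseSplit (stAtoms c) (λ bs → nextUntils (nu c) (nxAtoms c) (unAtoms c) (combo c bs)) Y
           (λ bs → size-nextUntils (nu c) (nxAtoms c) (unAtoms c) (combo c bs) (wt c + 30) weights hx)
           (≤-trans (≤-trans (m≤m+n _ _) (≤-trans (m≤m+n _ _) (m≤m+n _ 30))) (≤-pow* (2 + nu c + nx c) (wt c + 30))) ⟩
    x ^ ns c * Y                                 ≡⟨ pow*-merge (ns c) (2 + nu c + nx c) (wt c + 30) ⟩
    x ^ (ns c + (2 + nu c + nx c)) * (wt c + 30) ∎
    where
    Y : ℕ
    Y = x ^ (2 + nu c + nx c) * (wt c + 30)
    weights : wS (nxAtoms c) + wU (unAtoms c) + 30 ≤ wt c + 30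
    weights = +-monoˡ-≤ 30 (≤-trans (m≤n+m _ (wS (stAtoms c)))
                (≤-reflexive (sym (+-assoc (wS (stAtoms c)) (wS (nxAtoms c)) (wU (unAtoms c))))))

  -- The translation of  E ψ , with one extra symbol to spare for  A ψ .
  size-top : ∀ c → 6 * suc (nu c) ≤ x → 10 ≤ wt c → suc (size (existsNF c)) ≤ x ^ (natoms c + 3) * wt c
  size-top c hx hw = begin
    suc (size (existsNF c))  ≤⟨ +-mono-≤ (m^n>0 x e) (size-existsNF c hx) ⟩
    x ^ e + x ^ e * (w + 30) ≡⟨ factor (x ^ e) w ⟩
    x ^ e * (w + 31)         ≤⟨ *-monoʳ-≤ (x ^ e) (≤-trans w+31≤12w (*-monoˡ-≤ w 12≤x)) ⟩
    x ^ e * (x * w)          ≡⟨ rotate (x ^ e) x w ⟩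
    x ^ suc e * w            ≡⟨ cong (λ f → x ^ f * w) (exponent (ns c) (nx c) (nu c)) ⟩
    x ^ (natoms c + 3) * w   ∎
    where
    e w : ℕ
    e = ns c + (2 + nu c + nx c)
    w = wt c
    collect : ∀ w → w + 11 * w ≡ 12 * w
    collect = solve-∀
    w+31≤12w : w + 31 ≤ 12 * w
    w+31≤12w = ≤-trans (+-monoʳ-≤ w (≤-trans (≤-by {31} 79 refl) (*-monoʳ-≤ 11 hw))) (≤-reflexive (collect w))
    factor : ∀ p w → p + p * (w + 30) ≡ p * (w + 31)
    factor = solve-∀
    rotate : ∀ p x w → p * (x * w) ≡ x * p * w
    rotate = solve-∀
    exponent : ∀ a b c → suc (a + (2 + c + b)) ≡ a + b + c + 3
    exponent = solve-∀

  -- Steps of the induction over formulas, where a formula of size s is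
  -- translated to one of size at most x ^ (6 * s).
  unary-step : ∀ t m → t ≤ x ^ (6 * m) → suc t ≤ x ^ (6 * suc m)
  unary-step t m ht = begin
    suc t                     ≤⟨ +-mono-≤ (m^n>0 x (6 * m)) ht ⟩
    x ^ (6 * m) + x ^ (6 * m) ≡⟨ double (x ^ (6 * m)) ⟩
    2 * x ^ (6 * m)           ≤⟨ *-monoˡ-≤ (x ^ (6 * m)) (≤-trans (≤-by {2} 10 refl) 12≤x) ⟩
    x ^ suc (6 * m)           ≤⟨ ^-monoʳ-≤ x (≤-by 5 (slack m)) ⟩
    x ^ (6 * suc m)           ∎
    where
    double : ∀ y → y + y ≡ 2 * y
    double = solve-∀
    slack : ∀ m → suc (6 * m) + 5 ≡ 6 * suc m
    slack = solve-∀

  binary-step : ∀ t₁ t₂ m₁ m₂ → t₁ ≤ x ^ (6 * m₁) → t₂ ≤ x ^ (6 * m₂) → suc (t₁ + t₂) ≤ x ^ (6 * suc (m₁ + m₂))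
  binary-step t₁ t₂ m₁ m₂ h₁ h₂ = begin
    suc (t₁ + t₂) ≤⟨ s≤s (+-mono-≤ (≤-trans h₁ (^-monoʳ-≤ x (*-monoʳ-≤ 6 (m≤m+n m₁ m₂))))
                                   (≤-trans h₂ (^-monoʳ-≤ x (*-monoʳ-≤ 6 (m≤n+m m₂ m₁))))) ⟩
    suc (Y + Y)   ≤⟨ +-monoˡ-≤ (Y + Y) (m^n>0 x (6 * (m₁ + m₂))) ⟩
    Y + (Y + Y)   ≡⟨ triple Y ⟩
    3 * Y         ≤⟨ *-monoˡ-≤ Y (≤-trans (≤-by {3} 9 refl) 12≤x) ⟩
    x * Y         ≤⟨ ^-monoʳ-≤ x (≤-by 5 (slack (m₁ + m₂))) ⟩
    x ^ (6 * suc (m₁ + m₂)) ∎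
    where
    Y : ℕ
    Y = x ^ (6 * (m₁ + m₂))
    triple : ∀ y → y + (y + y) ≡ 3 * y
    triple = solve-∀
    slack : ∀ m → suc (6 * m) + 5 ≡ 6 * suc m
    slack = solve-∀

  pad : ∀ t e → t ≤ 2 * x ^ e → t + 10 ≤ 12 * x ^ e
  pad t e ht = ≤-trans (+-mono-≤ ht (*-monoʳ-≤ 10 (m^n>0 x e))) (≤-reflexive (collect (x ^ e)))
    where
    collect : ∀ y → 2 * y + 10 * y ≡ 12 * y
    collect = solve-∀

  atom-step : ∀ W e f → W ≤ 12 * x ^ e → 5 + e ≤ f → x ^ 4 * W ≤ x ^ f
  atom-step W e f hW hf = begin
    x ^ 4 * W            ≤⟨ *-monoʳ-≤ (x ^ 4) (≤-trans hW (*-monoˡ-≤ (x ^ e) 12≤x)) ⟩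
    x ^ 4 * (x * x ^ e)  ≡⟨ ^-distribˡ-+-* x 4 (suc e) ⟨
    x ^ (5 + e)          ≤⟨ ^-monoʳ-≤ x hf ⟩
    x ^ f                ∎

  combine-step : ∀ n₁ n₂ m₁ m₂ w₁ w₂ → n₁ ≤ m₁ → n₂ ≤ m₂ →
    x ^ (n₁ + 3) * w₁ ≤ x ^ (6 * suc m₁) → x ^ (n₂ + 3) * w₂ ≤ x ^ (6 * suc m₂) →
    x ^ (n₁ + n₂ + 3) * (w₁ + w₂) ≤ x ^ (6 * suc (suc (m₁ + m₂)))
  combine-step n₁ n₂ m₁ m₂ w₁ w₂ n₁≤m₁ n₂≤m₂ q₁ q₂ = begin
    x ^ (n₁ + n₂ + 3) * (w₁ + w₂)                   ≡⟨ *-distribˡ-+ (x ^ (n₁ + n₂ + 3)) w₁ w₂ ⟩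
    x ^ (n₁ + n₂ + 3) * w₁ + x ^ (n₁ + n₂ + 3) * w₂ ≤⟨ +-mono-≤ part₁ part₂ ⟩
    x ^ F + x ^ F                                   ≡⟨ double (x ^ F) ⟩
    2 * x ^ F                                       ≤⟨ *-monoˡ-≤ (x ^ F) (≤-trans (≤-by {2} 10 refl) 12≤x) ⟩
    x ^ suc F                                       ≡⟨ cong (x ^_) (exponent m₁ m₂) ⟩
    x ^ (6 * suc (suc (m₁ + m₂)))                   ∎
    where
    F : ℕ
    F = 6 * m₁ + 6 * m₂ + 11
    double : ∀ y → y + y ≡ 2 * y
    double = solve-∀
    exponent : ∀ a b → suc (6 * a + 6 * b + 11) ≡ 6 * suc (suc (a + b))
    exponent = solve-∀
    slack₁ : ∀ a b → b + 6 * suc a + (5 * b + 5) ≡ 6 * a + 6 * b + 11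
    slack₁ = solve-∀
    slack₂ : ∀ a b → a + 6 * suc b + (5 * a + 5) ≡ 6 * a + 6 * b + 11
    slack₂ = solve-∀
    shift : ∀ a n w f → x ^ (n + 3) * w ≤ x ^ f → x ^ (a + n + 3) * w ≤ x ^ (a + f)
    shift a n w f q = begin
      x ^ (a + n + 3) * w       ≡⟨ cong (λ e → x ^ e * w) (+-assoc a n 3) ⟩
      x ^ (a + (n + 3)) * w     ≡⟨ pow*-merge a (n + 3) w ⟨
      x ^ a * (x ^ (n + 3) * w) ≤⟨ *-monoʳ-≤ (x ^ a) q ⟩
      x ^ a * x ^ f             ≡⟨ ^-distribˡ-+-* x a f ⟨
      x ^ (a + f)               ∎
    part₁ : x ^ (n₁ + n₂ + 3) * w₁ ≤ x ^ F
    part₁ = begin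
      x ^ (n₁ + n₂ + 3) * w₁ ≡⟨ cong (λ e → x ^ (e + 3) * w₁) (+-comm n₁ n₂) ⟩
      x ^ (n₂ + n₁ + 3) * w₁ ≤⟨ shift n₂ n₁ w₁ (6 * suc m₁) q₁ ⟩
      x ^ (n₂ + 6 * suc m₁)  ≤⟨ ^-monoʳ-≤ x (≤-trans (+-monoˡ-≤ (6 * suc m₁) n₂≤m₂) (≤-by (5 * m₂ + 5) (slack₁ m₁ m₂))) ⟩
      x ^ F                  ∎
    part₂ : x ^ (n₁ + n₂ + 3) * w₂ ≤ x ^ F
    part₂ = begin
      x ^ (n₁ + n₂ + 3) * w₂ ≤⟨ shift n₁ n₂ w₂ (6 * suc m₂) q₂ ⟩
      x ^ (n₁ + 6 * suc m₂)  ≤⟨ ^-monoʳ-≤ x (≤-trans (+-monoˡ-≤ (6 * suc m₂) n₁≤m₁) (≤-by (5 * m₁ + 5) (slack₂ m₁ m₂))) ⟩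
      x ^ F                  ∎

  -- For formulas of size at most N, with x ≥ 6 (N + 1):
  -- |tr φ| ≤ x ^ (6 |φ|)  and, for the normal form c of a path formula ψ,
  -- x ^ (natoms c + 3) * wt c ≤ x ^ (6 (|ψ| + 1)).
  module Formulas (N : ℕ) (hN : 6 * suc N ≤ x) where
    few-untils : ∀ ψ (d : IsHCTL+Path ψ) → suc (sizeP ψ) ≤ N → 6 * suc (nu (normalForm ψ d)) ≤ x
    few-untils ψ d hs = ≤-trans (*-monoʳ-≤ 6 (s≤s (≤-trans (m≤n+m _ _) (≤-trans (natoms≤size ψ d) (≤-trans (n≤1+n _) hs))))) hN

    left : ∀ ψ χ → suc (suc (sizeP ψ + sizeP χ)) ≤ N → suc (sizeP ψ) ≤ N
    left ψ χ hs = ≤-trans (s≤s (m≤m+n _ _)) (≤-trans (n≤1+n _) hs)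

    right : ∀ ψ χ → suc (suc (sizeP ψ + sizeP χ)) ≤ N → suc (sizeP χ) ≤ N
    right ψ χ hs = ≤-trans (s≤s (m≤n+m _ _)) (≤-trans (n≤1+n _) hs)

    combined : ∀ op ψ χ (d : IsHCTL+Path ψ) (e : IsHCTL+Path χ) → suc (suc (sizeP ψ + sizeP χ)) ≤ N →
      x ^ (natoms (normalForm ψ d) + 3) * wt (normalForm ψ d) ≤ x ^ (6 * suc (sizeP ψ)) →
      x ^ (natoms (normalForm χ e) + 3) * wt (normalForm χ e) ≤ x ^ (6 * suc (sizeP χ)) →
      x ^ (natoms (combine op (normalForm ψ d) (normalForm χ e)) + 3) * wt (combine op (normalForm ψ d) (normalForm χ e))
        ≤ x ^ (6 * suc (suc (sizeP ψ + sizeP χ)))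
    combined op ψ χ d e hs q₁ q₂ =
      subst₂ (λ n w → x ^ (n + 3) * w ≤ x ^ (6 * suc (suc (sizeP ψ + sizeP χ))))
        (sym (natoms-combine op (normalForm ψ d) (normalForm χ e))) (sym (wt-combine op (normalForm ψ d) (normalForm χ e)))
        (combine-step _ _ (sizeP ψ) (sizeP χ) _ _ (natoms≤size ψ d) (natoms≤size χ e) q₁ q₂)

    mutual
      size-tr : ∀ φ (d : IsHCTL+ φ) → size φ ≤ N → size (tr φ d) ≤ x ^ (6 * size φ)
      size-tr (atom p)    _           hs = m^n>0 x 6
      size-tr (¬s φ)      (¬s d)      hs = unary-step _ (size φ) (size-tr φ d (≤-trans (n≤1+n _) hs))
      size-tr (φ ∨s ψ)    (d ∨s e)    hs = binary-step _ _ (size φ) (size ψ)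
        (size-tr φ d (≤-trans (m≤m+n _ _) (≤-trans (n≤1+n _) hs))) (size-tr ψ e (≤-trans (m≤n+m _ _) (≤-trans (n≤1+n _) hs)))
      size-tr (φ ∧s ψ)    (d ∧s e)    hs = binary-step _ _ (size φ) (size ψ)
        (size-tr φ d (≤-trans (m≤m+n _ _) (≤-trans (n≤1+n _) hs))) (size-tr ψ e (≤-trans (m≤n+m _ _) (≤-trans (n≤1+n _) hs)))
      size-tr (E ψ)       (E d)       hs = ≤-trans (n≤1+n _)
        (≤-trans (size-top (normalForm ψ d) (few-untils ψ d hs) (10≤wt ψ d)) (nf-bound ψ d hs))
      size-tr (A ψ)       (A d)       hs =
        ≤-trans (size-top (negNF (normalForm ψ d)) (few-untils ψ d hs) (10≤wt ψ d)) (nf-bound ψ d hs)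
      size-tr (↓x φ)      (↓x d)      hs = unary-step _ (size φ) (size-tr φ d (≤-trans (n≤1+n _) hs))
      size-tr var-x       _           hs = m^n>0 x 6
      size-tr (at-x φ)    (at-x d)    hs = unary-step _ (size φ) (size-tr φ d (≤-trans (n≤1+n _) hs))
      size-tr root        _           hs = m^n>0 x 6
      size-tr (at-root φ) (at-root d) hs = unary-step _ (size φ) (size-tr φ d (≤-trans (n≤1+n _) hs))

      nf-bound : ∀ ψ (d : IsHCTL+Path ψ) → suc (sizeP ψ) ≤ N →
                 x ^ (natoms (normalForm ψ d) + 3) * wt (normalForm ψ d) ≤ x ^ (6 * suc (sizeP ψ))
      nf-bound (st φ) (st d) hs = atom-step _ (6 * size φ) (6 * suc (size φ))
        (≤-trans (≤-reflexive (zeros (size (tr φ d)))) (pad (size (tr φ d)) (6 * size φ)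
          (≤-trans (size-tr φ d (≤-trans (n≤1+n _) hs)) (m≤n*m _ 2))))
        (≤-by 1 (slack (size φ)))
        where
        zeros : ∀ t → t + 10 + 0 + 0 + 0 ≡ t + 10
        zeros = solve-∀
        slack : ∀ s → 5 + 6 * s + 1 ≡ 6 * suc s
        slack = solve-∀
      nf-bound (X (st φ)) (X d) hs = atom-step _ (6 * size φ) (6 * suc (suc (size φ)))
        (≤-trans (≤-reflexive (zeros (size (tr φ d)))) (pad (size (tr φ d)) (6 * size φ)
          (≤-trans (size-tr φ d (≤-trans (n≤1+n _) (≤-trans (n≤1+n _) hs))) (m≤n*m _ 2))))
        (≤-by 7 (slack (size φ)))
        where
        zeros : ∀ t → 0 + (t + 10 + 0) + 0 ≡ t + 10
        zeros = solve-∀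
        slack : ∀ s → 5 + 6 * s + 7 ≡ 6 * suc (suc s)
        slack = solve-∀
      nf-bound (st a U st b) (d U e) hs = atom-step _ (6 * (size a + size b)) (6 * suc (suc (size a + size b)))
        (≤-trans (≤-reflexive (zeros (size (tr a d)) (size (tr b e))))
          (pad (size (tr a d) + size (tr b e)) (6 * (size a + size b))
            (≤-trans (+-mono-≤ (≤-trans (size-tr a d ha) (^-monoʳ-≤ x (*-monoʳ-≤ 6 (m≤m+n (size a) (size b)))))
                               (≤-trans (size-tr b e hb) (^-monoʳ-≤ x (*-monoʳ-≤ 6 (m≤n+m (size b) (size a))))))
                     (≤-reflexive (double (x ^ (6 * (size a + size b))))))))
        (≤-by 7 (slack (size a + size b)))
        where
        ha : size a ≤ N
        ha = ≤-trans (m≤m+n _ _) (≤-trans (n≤1+n _) (≤-trans (n≤1+n _) hs))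
        hb : size b ≤ N
        hb = ≤-trans (m≤n+m _ _) (≤-trans (n≤1+n _) (≤-trans (n≤1+n _) hs))
        zeros : ∀ p q → 0 + 0 + (p + q + 10 + 0) ≡ p + q + 10
        zeros = solve-∀
        double : ∀ y → y + y ≡ 2 * y
        double = solve-∀
        slack : ∀ s → 5 + 6 * s + 7 ≡ 6 * suc (suc s)
        slack = solve-∀
      nf-bound (¬p ψ) (¬p d) hs = ≤-trans (nf-bound ψ d (≤-trans (n≤1+n _) hs))
        (^-monoʳ-≤ x (*-monoʳ-≤ 6 (n≤1+n (suc (sizeP ψ)))))
      nf-bound (ψ ∨p χ) (d ∨p e) hs = combined _∨_ ψ χ d e hs (nf-bound ψ d (left ψ χ hs)) (nf-bound χ e (right ψ χ hs))
      nf-bound (ψ ∧p χ) (d ∧p e) hs = combined _∧_ ψ χ d e hs (nf-bound ψ d (left ψ χ hs)) (nf-bound χ e (right ψ χ hs))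

-- The size bound is in 2^O(n log n).

n≤2^⌈log₂n⌉ : ∀ n → n ≤ 2 ^ ⌈log₂ n ⌉
n≤2^⌈log₂n⌉ n = bound n (<-wellFounded n)
  where
  bound : ∀ n (a : Acc _<_ n) → n ≤ 2 ^ ⌈log2⌉ n a
  bound zero          _        = z≤n
  bound (suc zero)    _        = s≤s z≤n
  bound (suc (suc n)) (acc rs) = begin
    suc (suc n)               ≤⟨ s≤s (s≤s (≤-trans (≤-reflexive (sym (⌊n/2⌋+⌈n/2⌉≡n n)))
                                                    (+-monoˡ-≤ ⌈ n /2⌉ (⌊n/2⌋≤⌈n/2⌉ n)))) ⟩
    suc (suc (⌈ n /2⌉ + ⌈ n /2⌉)) ≡⟨ cong suc (sym (+-suc ⌈ n /2⌉ ⌈ n /2⌉)) ⟩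
    suc ⌈ n /2⌉ + suc ⌈ n /2⌉ ≡⟨ cong (suc ⌈ n /2⌉ +_) (sym (+-identityʳ _)) ⟩
    2 * suc ⌈ n /2⌉           ≤⟨ *-monoʳ-≤ 2 (bound (suc ⌈ n /2⌉) _) ⟩
    2 * 2 ^ ⌈log2⌉ (suc ⌈ n /2⌉) _ ∎

translationBound : ℕ → ℕ
translationBound n = (12 * suc n) ^ (6 * n)

translationBound-growth : In2^O[nlogn] translationBound
translationBound-growth = 12 , 13 , λ n 13≤n → let L = ⌈log₂ n ⌉ in begin
  (12 * suc n) ^ (6 * n)       ≤⟨ ^-monoˡ-≤ (6 * n) (12[n+1]≤n² n 13≤n) ⟩
  (n * n) ^ (6 * n)            ≤⟨ ^-monoˡ-≤ (6 * n) (*-mono-≤ (n≤2^⌈log₂n⌉ n) (n≤2^⌈log₂n⌉ n)) ⟩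
  (2 ^ L * 2 ^ L) ^ (6 * n)    ≡⟨ cong (_^ (6 * n)) (^-distribˡ-+-* 2 L L) ⟨
  (2 ^ (L + L)) ^ (6 * n)      ≡⟨ ^-*-assoc 2 (L + L) (6 * n) ⟩
  2 ^ ((L + L) * (6 * n))      ≡⟨ cong (2 ^_) (regroup n L) ⟩
  2 ^ (12 * (n * L))           ∎
  where
  regroup : ∀ n L → (L + L) * (6 * n) ≡ 12 * (n * L)
  regroup = solve-∀
  12[n+1]≤n² : ∀ n → 13 ≤ n → 12 * suc n ≤ n * n
  12[n+1]≤n² n 13≤n = begin
    12 * suc n   ≡⟨ expand n ⟩
    12 + 12 * n  ≤⟨ +-monoˡ-≤ (12 * n) (≤-trans (n≤1+n 12) 13≤n) ⟩
    n + 12 * n   ≡⟨ collect n ⟩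
    13 * n       ≤⟨ *-monoˡ-≤ n 13≤n ⟩
    n * n        ∎
    where
    expand : ∀ n → 12 * suc n ≡ 12 + 12 * n
    expand = solve-∀
    collect : ∀ n → n + 12 * n ≡ 13 * n
    collect = solve-∀

tr-equivalent : ExcludedMiddle 0ℓ → ∀ φ (d : IsHCTL+ φ) → φ ≅ tr φ d
tr-equivalent em φ d T v u = Equivalence.to eq , Equivalence.from eq
  where
  eq : ⟦ φ ⟧ T v u ⇔ ⟦ tr φ d ⟧ T v u
  eq = Correctness.tr-correct em T φ d v u

-- ... and its size is bounded by  translationBound , taking x = 12 (n + 1).
tr-size : ∀ φ (d : IsHCTL+ φ) → size (tr φ d) ≤ translationBound (size φ)
tr-size φ d = SizeBound.Formulas.size-tr (12 * suc n) (m≤m*n 12 (suc n)) n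
  (*-monoˡ-≤ (suc n) (≤-by {6} 6 refl)) φ d ≤-refl
  where
  n : ℕ
  n = size φ

corollary1 : ExcludedMiddle 0ℓ →
    Σ (ℕ → ℕ) λ h → In2^O[nlogn] h ×
      (∀ (φ : StateF) → IsHCTL+ φ →
        Σ StateF λ φ′ → IsHCTL φ′ × (φ ≅ φ′) × (size φ′ ≤ h (size φ)))
corollary1 em = translationBound , translationBound-growth ,
  λ φ d → tr φ d , tr-HCTL φ d , tr-equivalent em φ d , tr-size φ d
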